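{- For all integers $n\ge 1$ and $s\ge 2$, $\chi_{ltna}(C_{4n+2}\vee W_{2s})=5$.
   Context: All graphs are finite and simple. $C_k$ is the cycle on $k$ vertices. $W_{2s}$ is the wheel of order $2s+1$: $V(W_{2s})=\{v_j\mid 1\le j\le 2s+1\}$ and $E(W_{2s})=\{v_1v_{2s}\}\cup\{v_jv_{j+1}\mid 1\le j\le 2s-1\}\cup\{v_jv_{2s+1}\mid 1\le j\le 2s\}$. The join $G\vee H$ of (vertex-disjoint) graphs has $V(G\vee H)=V(G)\cup V(H)$ and $E(G\vee H)=E(G)\cup E(H)\cup\{uv\mid u\in V(G),v\in V(H)\}$. For a graph $G=(V,E)$ of order $p$ and size $q$ without isolated vertices, a bijection $f:V\cup E\to\{1,\dots,p+q\}$ is a local total neighborhood antimagic labeling of $G$ if the induced vertex coloring $f^+_{tn}(u)=\sum_{ux\in E}[f(ux)+f(x)]$ satisfies $f^+_{tn}(u)\ne f^+_{tn}(v)$ for every edge $uv\in E$. The number of distinct induced colors is $c_{tn}(f)$. The local total neighborhood antimagic chromatic number $\chi_{ltna}(G)$ is the minimum of $c_{tn}(f)$ over all local total neighborhood antimagic labelings $f$ of $G$; an assertion $\chi_{ltna}(G)=k$ includes the assertion that $G$ admits such a labeling. -}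

module Defs where

open import Data.Empty using (⊥-elim)
open import Data.Fin using (Fin; toℕ; splitAt; _<_; _<?_)
open import Data.Fin.Properties using (<-cmp; _≟_)
open import Data.List using (List; allFin; cartesianProduct; deduplicate; filter; length; map)
import Data.Nat as ℕ
open import Data.Nat using (ℕ; suc; _+_; _≤_)
open import Data.Nat.ListAction using (sum)
open import Data.Product using (∃-syntax; _×_; _,_)
open import Data.Sum using (_⊎_; inj₁; inj₂; swap)
open import Data.Unit using (⊤; tt)
open import Function.Bundles using (_⤖_; module Bijection)
open import Level using (0ℓ)
open import Relation.Binary.Core using (Rel)
open import Relation.Binary.Definitions using (Decidable; Symmetric; tri<; tri≈; tri>)
open import Relation.Binary.PropositionalEquality using (_≡_; _≢_; refl; ≢-sym)
open import Relation.Nullary using (¬_; Dec; yes; no)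
open import Relation.Nullary.Decidable using (_×-dec_; _⊎-dec_; ¬?)

record Graph : Set₁ where
  field
    order  : ℕ
    Adj    : Rel (Fin order) 0ℓ
    adj?   : Decidable Adj
    sym    : Symmetric Adj
    irrefl : ∀ {u} → ¬ Adj u u

  Vertex : Set
  Vertex = Fin order

  -- An unordered edge is represented once, with its smaller endpoint first.
  -- The proofs are irrelevant so that edges with equal endpoints are equal.
  record Edge : Set where
    constructor mkEdge
    field
      lo hi  : Vertex
      .lo<hi : lo < hi
      .adj   : Adj lo hi

  edge : ∀ {u v} → Adj u v → Edge
  edge {u} {v} a with <-cmp u v
  ... | tri< u<v _ _  = mkEdge u v u<v a
  ... | tri≈ _ refl _ = ⊥-elim (irrefl a)
  ... | tri> _ _ v<u  = mkEdge v u v<u (sym a)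

  size : ℕ
  size = length (filter (λ (u , v) → (u <? v) ×-dec adj? u v)
                        (cartesianProduct (allFin order) (allFin order)))

open Graph using (Vertex; Edge)

-- The simple graph whose edges are the pairs {u, v}, u ≢ v, related by R in
-- at least one direction.
fromRel : ∀ {p} {R : Rel (Fin p) 0ℓ} → Decidable R → Graph
fromRel {p} {R} R? = record
  { order  = p
  ; Adj    = λ u v → u ≢ v × (R u v ⊎ R v u)
  ; adj?   = λ u v → ¬? (u ≟ v) ×-dec (R? u v ⊎-dec R? v u)
  ; sym    = λ (u≢v , r) → ≢-sym u≢v , swap r
  ; irrefl = λ (u≢u , _) → u≢u refl
  }

-- v_j is the element of Fin with toℕ equal to j - 1.  These are the intended
-- cycle and wheel for k ≥ 3; smaller k give degenerate graphs.
C : ℕ → Graph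
C k = fromRel {p = k} {R = λ u v →
        (toℕ u ≡ 0 × suc (toℕ v) ≡ k)
      ⊎ suc (toℕ u) ≡ toℕ v}
    λ u v → ((toℕ u ℕ.≟ 0) ×-dec (suc (toℕ v) ℕ.≟ k))
      ⊎-dec (suc (toℕ u) ℕ.≟ toℕ v)

-- The hub is the vertex with toℕ equal to k; the rim has k vertices.
W : ℕ → Graph
W k = fromRel {p = k + 1} {R = λ u v →
        (toℕ u ≡ 0 × suc (toℕ v) ≡ k)
      ⊎ (suc (toℕ u) ≡ toℕ v × toℕ v ℕ.< k)
      ⊎ (toℕ u ℕ.< k × toℕ v ≡ k)}
    λ u v → ((toℕ u ℕ.≟ 0) ×-dec (suc (toℕ v) ℕ.≟ k))
      ⊎-dec ((suc (toℕ u) ℕ.≟ toℕ v) ×-dec (toℕ v ℕ.<? k))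
      ⊎-dec ((toℕ u ℕ.<? k) ×-dec (toℕ v ℕ.≟ k))

module _ (G H : Graph) where
  private
    module G = Graph G
    module H = Graph H

  JoinAdj : Rel (G.Vertex ⊎ H.Vertex) 0ℓ
  JoinAdj (inj₁ u) (inj₁ v) = G.Adj u v
  JoinAdj (inj₁ _) (inj₂ _) = ⊤
  JoinAdj (inj₂ _) (inj₁ _) = ⊤
  JoinAdj (inj₂ u) (inj₂ v) = H.Adj u v

  joinAdj? : Decidable JoinAdj
  joinAdj? (inj₁ u) (inj₁ v) = G.adj? u v
  joinAdj? (inj₁ _) (inj₂ _) = yes tt
  joinAdj? (inj₂ _) (inj₁ _) = yes tt
  joinAdj? (inj₂ u) (inj₂ v) = H.adj? u v

  joinAdj-sym : Symmetric JoinAdj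
  joinAdj-sym {inj₁ _} {inj₁ _} a = G.sym a
  joinAdj-sym {inj₁ _} {inj₂ _} _ = tt
  joinAdj-sym {inj₂ _} {inj₁ _} _ = tt
  joinAdj-sym {inj₂ _} {inj₂ _} a = H.sym a

  joinAdj-irrefl : ∀ x → ¬ JoinAdj x x
  joinAdj-irrefl (inj₁ _) = G.irrefl
  joinAdj-irrefl (inj₂ _) = H.irrefl

  -- The disjoint union of the vertex sets is identified with
  -- Fin (G.order + H.order) by splitAt, the vertices of G coming first.
  infixr 6 _∨_
  _∨_ : Graph
  _∨_ = record
    { order  = G.order + H.order
    ; Adj    = λ u v → JoinAdj (splitAt G.order u) (splitAt G.order v)
    ; adj?   = λ u v → joinAdj? (splitAt G.order u) (splitAt G.order v)
    ; sym    = λ {u} {v} → joinAdj-sym {splitAt G.order u} {splitAt G.order v}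
    ; irrefl = λ {u} → joinAdj-irrefl (splitAt G.order u)
    }

module _ (G : Graph) where
  open Graph G hiding (Vertex; Edge)

  NoIsolatedVertices : Set
  NoIsolatedVertices = ∀ u → ∃[ v ] Adj u v

  TotalLabeling : Set
  TotalLabeling = (Vertex G ⊎ Edge G) ⤖ Fin (order + size)

module _ {G : Graph} (f : TotalLabeling G) where
  open Graph G hiding (Vertex; Edge)

  -- Fin (p + q) is shifted by one to give the labels 1, …, p + q.
  label : Vertex G ⊎ Edge G → ℕ
  label x = suc (toℕ (Bijection.to f x))

  contribution : ∀ {u x} → Dec (Adj u x) → ℕ
  contribution {x = x} (yes ux) = label (inj₂ (edge ux)) + label (inj₁ x)
  contribution         (no _)   = 0

  f⁺ : Vertex G → ℕ
  f⁺ u = sum (map (λ x → contribution (adj? u x)) (allFin order))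

  IsLTNA : Set
  IsLTNA = ∀ {u v} → Adj u v → f⁺ u ≢ f⁺ v

  colorCount : ℕ
  colorCount = length (deduplicate ℕ._≟_ (map f⁺ (allFin order)))

record χltna_≡_ (G : Graph) (k : ℕ) : Set where
  field
    noIsolated : NoIsolatedVertices G
    attained   : ∃[ f ] IsLTNA {G} f × colorCount {G} f ≡ k
    minimal    : ∀ f → IsLTNA {G} f → k ≤ colorCount {G} f

{-# OPTIONS --safe #-}

-- An edge of the cycle and a triangle of the wheel span a K₅ in the join, so at least five colours
-- occur.  For the labeling, put r = 2n + 1, m = 2r and k = 2s.  The m × k array of cross edges
-- between cycle and rim is filled with 2 × 2 blocks (x, N − y; N − x, y) with y − x = s, so that
-- the row sums depend only on the parity of the row and the columns are balanced.  What remains at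
-- a cycle vertex is an edge to the hub, two cycle edges and two cycle vertices; these sums are
-- constant on parity classes because the vertices of one parity form an odd cycle, on which the
-- labels a ↦ a/2 mod r have neighbour sums in arithmetic progression.  On the rim, labeling
-- vertices upwards and edges and spokes downwards leaves sums decreasing by 1 along the rim, which
-- is absorbed by reversing half of the first pair of rows of the array.  So five colours remain:
-- two on the cycle, two on the rim and one at the hub.  They are distinct since the hub colour is
-- the largest, and the cycle colours exceed the rim colours exactly if r ≤ s.

module Submission where

import Algebra.Properties.CommutativeMonoid.Sum
import Data.Fin as Fin
open import Data.Fin using (Fin; zero; suc; toℕ; fromℕ<; combine; opposite; punchIn; punchOut; join; splitAt; _↑ˡ_; _↑ʳ_)
open import Data.Fin.Patterns using (0F; 1F; 2F; 3F; 4F)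
import Data.Fin.Permutation as Permutation
open import Data.Fin.Permutation using (Permutation′; _⟨$⟩ˡ_)
import Data.Fin.Properties as Fin
open import Data.Fin.Properties using
  ( toℕ-injective; toℕ<n; toℕ-fromℕ<; fromℕ<-injective; injective⇒≤; punchOut-injective; punchInᵢ≢i; toℕ-combine
  ; remQuot-combine; combine-surjective; opposite-prop; any?; toℕ-↑ˡ; toℕ-↑ʳ; ↑ˡ-injective; splitAt-↑ˡ; splitAt-↑ʳ
  ; splitAt-join; join-splitAt; +↔⊎; *↔× )
open import Data.List using (List; _∷_; length; lookup; filter; map; tabulate; allFin; cartesianProduct; deduplicate)
open import Data.List.Membership.Propositional using (_∈_)
open import Data.List.Membership.Propositional.Properties using
  ( ∈-lookup; ∈-filter⁺; ∈-filter⁻; ∈-cartesianProduct⁺; ∈-allFin; ∈-map⁺; ∈-map⁻; ∈-deduplicate⁺; ∈-deduplicate⁻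
  ; ∈-tabulate⁺; ∈-tabulate⁻ )
import Data.List.Membership.Setoid.Properties as Membership
open import Data.List.Properties using (map-tabulate; length-tabulate)
import Data.List.Relation.Unary.All as All
open import Data.List.Relation.Unary.AllPairs using (_∷_)
open import Data.List.Relation.Unary.Any using (index)
import Data.Nat as ℕ
open import Data.List.Relation.Unary.Unique.DecPropositional.Properties ℕ._≟_ using (deduplicate-!)
open import Data.List.Relation.Unary.Unique.Propositional using (Unique)
import Data.List.Relation.Unary.Unique.Propositional.Properties as Unique
open import Data.Nat using (ℕ; zero; suc; _+_; _*_; _≤_; _<_; _≥_; NonZero; z≤n; s≤s)
open import Data.Nat.DivMod using (_mod_; m<n⇒m%n≡m; n%n≡0; _%_; m%n<n)
import Data.Nat.ListAction as List
import Data.Nat.Properties as ℕ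
open import Data.Nat.Tactic.RingSolver using (solve-∀)
open import Data.Product using (∃-syntax; _×_; _,_; proj₁; proj₂)
open import Data.Product.Function.NonDependent.Propositional using (_×-↔_)
import Data.Sum as Sum
open import Data.Sum using (_⊎_; inj₁; inj₂)
open import Data.Sum.Function.Propositional using (_⊎-↔_)
open import Data.Sum.Properties using (inj₁-injective; inj₂-injective)
open import Data.Unit using (tt)
open import Data.Vec.Functional using (removeAt)
open import Function using (_∘_; id; Injective; Injection; Inverse; _↔_; _↣_; mk⤖; mk↣)
open import Function.Construct.Identity using (↔-id)
open import Function.Construct.Symmetry using (↔-sym)
open import Function.Properties.Inverse using (↔-trans; ↔⇒↣)
open import Relation.Binary using (tri<; tri≈; tri>)
open import Relation.Binary.PropositionalEquality renaming (sym to ≡-sym)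
open import Relation.Nullary using (¬_; Dec; yes; no; contradiction; recompute)
open import Relation.Nullary.Decidable using (_×-dec_)

open import Defs
open Graph using (Vertex; Edge)

open Algebra.Properties.CommutativeMonoid.Sum ℕ.+-0-commutativeMonoid
  using (sum; sum-cong-≗; sum-remove; sum-replicate-zero; ∑-distrib-+; sum-permute)
open ≡-Reasoning


-- The obstacle is the wrap-around of both cycles: a term at an index has to cancel against a term
-- at exactly the same index. At rim vertex j the edge from the predecessor cancels the
-- predecessor's label, and the spoke cancels the successor's label; the edge to the successor is
-- left and contributes -j. Columns 2l and 2l + 1 share block l, so if the array gives back 2l,
-- exactly the two values -δ with δ = 0, 1 remain. Reversing the large labels in one pair of rows
-- changes the column sums of block l by l - (s - 1 - l), of slope exactly 2; hence one pair of rows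
-- is the right amount. On the cycle the halves h satisfy h(a) + h(a + 1) = n + (a + 1 mod r), also
-- when a + 1 wraps to 0, because h inverts doubling modulo the odd number r. This is where the
-- length 4n + 2 enters. The remaining progression is absorbed by one label per vertex: a cycle edge
-- at even vertices, the hub edge at odd ones. Bijectivity is obtained by counting: labels are only
-- placed injectively below the right total.

-- Counting by injections.

lookup-injective : ∀ {A : Set} {xs : List A} → Unique xs → Injective _≡_ _≡_ (lookup xs)
lookup-injective (_ ∷ _)   {zero}  {zero}  _  = refl
lookup-injective (x∉ ∷ _)  {zero}  {suc j} eq = contradiction eq (All.lookup x∉ (∈-lookup j))
lookup-injective (x∉ ∷ _)  {suc i} {zero}  eq = contradiction (≡-sym eq) (All.lookup x∉ (∈-lookup i))
lookup-injective (_ ∷ xs!) {suc i} {suc j} eq = cong suc (lookup-injective xs! eq)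

Unique-⊆⇒length≤ : ∀ {A : Set} {xs ys : List A} → Unique xs → (∀ {x} → x ∈ xs → x ∈ ys) → length xs ≤ length ys
Unique-⊆⇒length≤ {xs = xs} xs! ⊆ys = injective⇒≤ {f = λ i → index (⊆ys (∈-lookup {xs = xs} i))}
  λ eq → lookup-injective xs! (Membership.index-injective (setoid _) (⊆ys _) (⊆ys _) eq)

-- A missed value `y` could be punched out of the codomain, leaving an injection of `Fin (suc n)`
-- into `Fin n`.
injective⇒surjective : ∀ {n} {f : Fin n → Fin n} → Injective _≡_ _≡_ f → ∀ y → ∃[ x ] f x ≡ y
injective⇒surjective {suc n} {f} inj y with any? (λ x → f x Fin.≟ y)
... | yes hit = hit
... | no miss = contradiction (injective⇒≤ λ {i} {j} eq → inj (punchOut-injective (y≢ i) (y≢ j) eq)) ℕ.1+n≰n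
  where y≢ : ∀ i → y ≢ f i
        y≢ i y≡fi = miss (i , ≡-sym y≡fi)

injective⇒permutation : ∀ {n} (f : Fin n → Fin n) → Injective _≡_ _≡_ f → Permutation′ n
injective⇒permutation f inj = Permutation.permutation f (proj₁ ∘ surj) (proj₂ ∘ surj) (λ x → inj (proj₂ (surj (f x))))
  where surj = injective⇒surjective inj

-- Finite sums over `Fin`.

sum-allFin : ∀ {n} (f : Fin n → ℕ) → List.sum (map f (allFin n)) ≡ sum f
sum-allFin {n} f = trans (cong List.sum (map-tabulate id f)) (go f)
  where
  go : ∀ {n} (f : Fin n → ℕ) → List.sum (tabulate f) ≡ sum f
  go {zero}  f = refl
  go {suc n} f = cong (f zero +_) (go (f ∘ suc))

sum-const : ∀ n c → sum {n} (λ _ → c) ≡ n * c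
sum-const zero    c = refl
sum-const (suc n) c = cong (c +_) (sum-const n c)

sum-zero : ∀ {n} {f : Fin n → ℕ} → (∀ i → f i ≡ 0) → sum f ≡ 0
sum-zero {n} f≗0 = trans (sum-cong-≗ f≗0) (sum-replicate-zero n)

sum-single : ∀ {n} (f : Fin n → ℕ) p → (∀ i → i ≢ p → f i ≡ 0) → sum f ≡ f p
sum-single {suc n} f p rest = trans (sum-remove f)
  (trans (cong (f p +_) (sum-zero λ i → rest (punchIn p i) (punchInᵢ≢i p i))) (ℕ.+-identityʳ (f p)))

sum-pair : ∀ {n} (f : Fin n → ℕ) p q → p ≢ q → (∀ i → i ≢ p → i ≢ q → f i ≡ 0) → sum f ≡ f p + f q
sum-pair {suc n} f p q p≢q rest = trans (sum-remove f) (cong (f p +_) (trans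
  (sum-single (removeAt f p) (punchOut p≢q) λ i i≢ → rest (punchIn p i) (punchInᵢ≢i p i)
     λ eq → i≢ (Fin.punchIn-injective p i _ (trans eq (≡-sym (Fin.punchIn-punchOut p≢q)))))
  (cong f (Fin.punchIn-punchOut p≢q))))

sum-↑ : ∀ m {n} (f : Fin (m + n) → ℕ) → sum f ≡ sum (λ i → f (i ↑ˡ n)) + sum (λ j → f (m ↑ʳ j))
sum-↑ zero    f = refl
sum-↑ (suc m) f = trans (cong (f zero +_) (sum-↑ m (f ∘ suc))) (≡-sym (ℕ.+-assoc (f zero) _ _))

sum-combine : ∀ m n (f : Fin (m * n) → ℕ) → sum f ≡ sum {m} λ i → sum {n} λ j → f (combine i j)
sum-combine zero    n f = refl
sum-combine (suc m) n f = trans (sum-↑ n f) (cong (sum (λ j → f (j ↑ˡ (m * n))) +_) (sum-combine m n (λ i → f (n ↑ʳ i))))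

sum-combine₂ : ∀ n (f : Fin (n * 2) → ℕ) → sum f ≡ sum {n} λ i → f (combine i 0F) + f (combine i 1F)
sum-combine₂ n f = trans (sum-combine n 2 f) (sum-cong-≗ λ (i : Fin n) → cong (f (combine i 0F) +_) (ℕ.+-identityʳ (f (combine i 1F))))

triangular : ℕ → ℕ
triangular n = sum {n} toℕ

-- This is n(n - 1)/2 in a form free of division and truncated subtraction.
triangular-double : ∀ n → triangular n + triangular n + n ≡ n * n
triangular-double zero    = refl
triangular-double (suc n) = begin
  s + s + suc n                          ≡⟨ cong (λ x → x + x + suc n) (trans (∑-distrib-+ (λ _ → 1) (toℕ {n})) (cong (_+ triangular n) (sum-const n 1))) ⟩
  (n * 1 + t) + (n * 1 + t) + suc n      ≡⟨ lem n t ⟩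
  suc (n + n + (t + t + n))              ≡⟨ cong (λ x → suc (n + n + x)) (triangular-double n) ⟩
  suc (n + n + n * n)                    ≡⟨ lem′ n ⟩
  suc n * suc n                          ∎
  where
  t = triangular n
  s = sum {n} λ i → suc (toℕ i)
  lem : ∀ n t → (n * 1 + t) + (n * 1 + t) + suc n ≡ suc (n + n + (t + t + n))
  lem = solve-∀
  lem′ : ∀ n → suc (n + n + n * n) ≡ suc n * suc n
  lem′ = solve-∀

-- The cyclic successor.

next : ∀ {n} .{{_ : NonZero n}} → Fin n → Fin n
next {n} i = suc (toℕ i) mod n

module _ {n} .{{nz : NonZero n}} where

  data NextView (i : Fin n) : Set where
    step : suc (toℕ i) < n → toℕ (next i) ≡ suc (toℕ i) → NextView i
    wrap : suc (toℕ i) ≡ n → toℕ (next i) ≡ 0 → NextView i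

  private
    toℕ-next : ∀ (i : Fin n) → toℕ (next i) ≡ suc (toℕ i) % n
    toℕ-next i = toℕ-fromℕ< (m%n<n (suc (toℕ i)) n)

  nextView : ∀ i → NextView i
  nextView i with ℕ.m≤n⇒m<n∨m≡n (toℕ<n i)
  ... | inj₁ si<n = step si<n (trans (toℕ-next i) (m<n⇒m%n≡m si<n))
  ... | inj₂ si≡n = wrap si≡n (trans (toℕ-next i) (trans (cong (_% n) si≡n) (n%n≡0 n)))

  next-injective : Injective _≡_ _≡_ (next {n})
  next-injective {i} {j} eq with nextView i | nextView j | cong toℕ eq
  ... | step _ p | step _ q | e = toℕ-injective (ℕ.suc-injective (trans (≡-sym p) (trans e q)))
  ... | step _ p | wrap _ q | e = contradiction (trans (≡-sym p) (trans e q)) λ ()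
  ... | wrap _ p | step _ q | e = contradiction (trans (≡-sym p) (trans e q)) λ ()
  ... | wrap p _ | wrap q _ | _ = toℕ-injective (ℕ.suc-injective (trans p (≡-sym q)))

  rotation : Permutation′ n
  rotation = injective⇒permutation next next-injective

  -- Taken as the inverse of an injective self-map, which spares a second case distinction at the
  -- wrap-around.
  prev : Fin n → Fin n
  prev = rotation ⟨$⟩ˡ_

  next-prev : ∀ i → next (prev i) ≡ i
  next-prev i = Permutation.inverseʳ rotation

  prev-injective : Injective _≡_ _≡_ prev
  prev-injective {i} {j} eq = trans (≡-sym (next-prev i)) (trans (cong next eq) (next-prev j))

  next-step : ∀ {i j} → suc (toℕ i) ≡ toℕ j → next i ≡ j
  next-step {i} {j} eq with nextView i
  ... | step _ p = toℕ-injective (trans p eq)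
  ... | wrap p _ = contradiction (trans (≡-sym eq) p) (ℕ.<⇒≢ (toℕ<n j))

  next-wrap : ∀ {i j} → suc (toℕ i) ≡ n → toℕ j ≡ 0 → next i ≡ j
  next-wrap {i} p q with nextView i
  ... | step p′ _ = contradiction p (ℕ.<⇒≢ p′)
  ... | wrap _ q′ = toℕ-injective (trans q′ (≡-sym q))

  next≢ : 2 ≤ n → ∀ i → next i ≢ i
  next≢ 2≤n i eq with nextView i
  ... | step _ p = ℕ.1+n≢n (trans (≡-sym p) (cong toℕ eq))
  ... | wrap p q with refl ← trans (≡-sym p) (cong suc (trans (cong toℕ (≡-sym eq)) q)) = contradiction 2≤n λ { (s≤s ()) }

  -- On two vertices both neighbours of a vertex coincide. From three on, the edges `i` and `next i`
  -- are distinct and the neighbour sum at a vertex has two separate terms.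
  next²≢ : 3 ≤ n → ∀ i → next (next i) ≢ i
  next²≢ 3≤n i eq with nextView i | nextView (next i)
  ... | step _ p | step _ q = ℕ.m+1+n≢n 1 (trans (cong suc (≡-sym p)) (trans (≡-sym q) (cong toℕ eq)))
  ... | step _ p | wrap q r with refl ← trans (≡-sym q) (cong suc (trans p (cong suc (trans (cong toℕ (≡-sym eq)) r)))) = contradiction 3≤n λ { (s≤s (s≤s ())) }
  ... | wrap p q | step _ r with refl ← trans (≡-sym p) (cong suc (trans (cong toℕ (≡-sym eq)) (trans r (cong suc q)))) = contradiction 3≤n λ { (s≤s (s≤s ())) }
  ... | wrap p q | wrap _ r with refl ← trans (≡-sym p) (cong suc (trans (cong toℕ (≡-sym eq)) r)) = contradiction 3≤n λ { (s≤s ()) }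

-- Reversal, and injective placement of blocks of labels.

↑ˡ≢↑ʳ : ∀ {m n} (i : Fin m) (j : Fin n) → i ↑ˡ n ≢ m ↑ʳ j
↑ˡ≢↑ʳ {m} {n} i j eq with () ← trans (≡-sym (splitAt-↑ˡ m i n)) (trans (cong (splitAt m) eq) (splitAt-↑ʳ m n j))

toℕ-opposite : ∀ {n} (i : Fin n) → toℕ i + suc (toℕ (opposite i)) ≡ n
toℕ-opposite {n} i = begin
  toℕ i + suc (toℕ (opposite i))   ≡⟨ cong (λ x → toℕ i + suc x) (opposite-prop i) ⟩
  toℕ i + suc (n ℕ.∸ suc (toℕ i))  ≡⟨ ℕ.+-suc (toℕ i) _ ⟩
  suc (toℕ i) + (n ℕ.∸ suc (toℕ i)) ≡⟨ ℕ.m+[n∸m]≡n (toℕ<n i) ⟩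
  n ∎

opposite-injective : ∀ {n} → Injective _≡_ _≡_ (opposite {n})
opposite-injective {x = i} {j} eq = trans (≡-sym (Fin.opposite-involutive i)) (trans (cong opposite eq) (Fin.opposite-involutive j))

-- Positions are natural numbers with a bound rather than elements of `Fin n`, so that block offsets
-- can be added without casts and passed to the ring solver. Only injectivity is recorded; once `n`
-- is the size of the whole set, surjectivity follows by counting.
record Packing (A : Set) (n : ℕ) : Set where
  field
    at        : A → ℕ
    at<n      : ∀ x → at x < n
    injective : Injective _≡_ _≡_ at

open Packing

finPacking : ∀ n → Packing (Fin n) n
finPacking n = record { at = toℕ ; at<n = toℕ<n ; injective = toℕ-injective }

infixl 6 _⊕_
_⊕_ : ∀ {A B m n} → Packing A m → Packing B n → Packing (A ⊎ B) (m + n)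
at (_⊕_ P Q) (inj₁ x) = at P x
at (_⊕_ {m = m} P Q) (inj₂ y) = m + at Q y
at<n (_⊕_ {m = m} {n} P Q) (inj₁ x) = ℕ.<-≤-trans (at<n P x) (ℕ.m≤m+n m n)
at<n (_⊕_ {m = m} {n} P Q) (inj₂ y) = ℕ.+-monoʳ-< m (at<n Q y)
injective (P ⊕ Q) {inj₁ x} {inj₁ x′} eq = cong inj₁ (injective P eq)
injective (_⊕_ {m = m} P Q) {inj₁ x} {inj₂ y} eq = contradiction eq (ℕ.<⇒≢ (ℕ.<-≤-trans (at<n P x) (ℕ.m≤m+n m _)))
injective (_⊕_ {m = m} P Q) {inj₂ y} {inj₁ x} eq = contradiction (≡-sym eq) (ℕ.<⇒≢ (ℕ.<-≤-trans (at<n P x) (ℕ.m≤m+n m _)))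
injective (_⊕_ {m = m} P Q) {inj₂ y} {inj₂ y′} eq = cong inj₂ (injective Q (ℕ.+-cancelˡ-≡ m _ _ eq))

_∘ₚ_ : ∀ {A B n} → Packing B n → A ↣ B → Packing A n
at (P ∘ₚ f) = at P ∘ Injection.to f
at<n (P ∘ₚ f) = at<n P ∘ Injection.to f
injective (P ∘ₚ f) = Injection.injective f ∘ injective P

-- Unordered pairs and named edges.

SamePair : ∀ {A : Set} → A → A → A → A → Set
SamePair a b c d = (a ≡ c × b ≡ d) ⊎ (a ≡ d × b ≡ c)

module _ {A : Set} where

  samePair-sym : ∀ {a b c d : A} → SamePair a b c d → SamePair c d a b
  samePair-sym (inj₁ (refl , refl)) = inj₁ (refl , refl)
  samePair-sym (inj₂ (refl , refl)) = inj₂ (refl , refl)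

  samePair-trans : ∀ {a b c d e f : A} → SamePair a b c d → SamePair c d e f → SamePair a b e f
  samePair-trans (inj₁ (refl , refl)) q = q
  samePair-trans (inj₂ (refl , refl)) (inj₁ (refl , refl)) = inj₂ (refl , refl)
  samePair-trans (inj₂ (refl , refl)) (inj₂ (refl , refl)) = inj₁ (refl , refl)

  samePair-map : ∀ {B : Set} (g : A → B) {a b c d} → SamePair a b c d → SamePair (g a) (g b) (g c) (g d)
  samePair-map g (inj₁ (refl , refl)) = inj₁ (refl , refl)
  samePair-map g (inj₂ (refl , refl)) = inj₂ (refl , refl)

  samePair-map⁻ : ∀ {B : Set} {g : A → B} → Injective _≡_ _≡_ g → ∀ {a b c d} → SamePair (g a) (g b) (g c) (g d) → SamePair a b c d
  samePair-map⁻ inj (inj₁ (p , q)) = inj₁ (inj p , inj q)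
  samePair-map⁻ inj (inj₂ (p , q)) = inj₂ (inj p , inj q)

-- Names each edge exactly once, in an orientation of its own choice. Labels can then be prescribed
-- on structured names such as "edge from `i` to `next i`", while `Edge` orders endpoints by size,
-- which treats the wrap-around edge differently.
record EdgeEnumeration (G : Graph) (E : Set) : Set where
  open Graph G using (Adj)
  field
    src tgt  : E → Vertex G
    adjacent : ∀ e → Adj (src e) (tgt e)
    code     : ∀ {u v} → Adj u v → E
    ends     : ∀ {u v} (a : Adj u v) → SamePair (src (code a)) (tgt (code a)) u v
    distinct : ∀ {e e′} → SamePair (src e) (tgt e) (src e′) (tgt e′) → e ≡ e′

module _ {G : Graph} where
  open Graph G using (Adj; adj?; sym; irrefl; order; size; edge; mkEdge)
  open Edge

  -- `edge` uses the adjacency proof only in an irrelevant field, so both sides compute to the same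
  -- record once the comparisons are settled.
  edge-cong : ∀ {u v u′ v′} (a : Adj u v) (b : Adj u′ v′) → SamePair u v u′ v′ → edge a ≡ edge b
  edge-cong {u} {v} a b (inj₁ (refl , refl)) with Fin.<-cmp u v
  ... | tri< _ _ _    = refl
  ... | tri≈ _ refl _ = contradiction a irrefl
  ... | tri> _ _ _    = refl
  edge-cong {u} {v} a b (inj₂ (refl , refl)) with Fin.<-cmp u v | Fin.<-cmp v u
  ... | tri< _ _ _    | tri> _ _ _   = refl
  ... | tri> _ _ _    | tri< _ _ _   = refl
  ... | tri≈ _ refl _ | _            = contradiction a irrefl
  ... | tri< _ _ _    | tri≈ _ refl _ = contradiction a irrefl
  ... | tri> _ _ _    | tri≈ _ refl _ = contradiction a irrefl
  ... | tri< p _ _    | tri< _ _ q   = contradiction p q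
  ... | tri> _ _ p    | tri> q _ _   = contradiction p q

  edge-ends : ∀ {u v} (a : Adj u v) → SamePair (lo (edge a)) (hi (edge a)) u v
  edge-ends {u} {v} a with Fin.<-cmp u v
  ... | tri< _ _ _    = inj₁ (refl , refl)
  ... | tri≈ _ refl _ = contradiction a irrefl
  ... | tri> _ _ _    = inj₂ (refl , refl)

  edge-increasing : (e : Edge G) → lo e Fin.< hi e
  -- The field is irrelevant, but the order is decidable, so a usable proof can be recomputed.
  edge-increasing (mkEdge u v u<v _) = recompute (u Fin.<? v) u<v

  edge-adjacent : (e : Edge G) → Adj (lo e) (hi e)
  edge-adjacent (mkEdge u v _ a) = recompute (adj? u v) a

  edge-edge-adjacent : (e : Edge G) → edge (edge-adjacent e) ≡ e
  edge-edge-adjacent e with Fin.<-cmp (lo e) (hi e)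
  ... | tri< _ _ _ = refl
  ... | tri≈ p _ _ = contradiction (edge-increasing e) p
  ... | tri> p _ _ = contradiction (edge-increasing e) p

  Edge↣Fin : Edge G ↣ Fin size
  Edge↣Fin = mk↣ {to = λ e → index (∈pairs e)} λ {e} {e′} eq → edge-≡ (Membership.index-injective (setoid _) (∈pairs e) (∈pairs e′) eq)
    where
    ∈pairs : ∀ e → (lo e , hi e) ∈ filter (λ (u , v) → (u Fin.<? v) ×-dec adj? u v) (cartesianProduct (allFin order) (allFin order))
    ∈pairs e = ∈-filter⁺ _ (∈-cartesianProduct⁺ (∈-allFin (lo e)) (∈-allFin (hi e))) (edge-increasing e , edge-adjacent e)
    edge-≡ : ∀ {e e′ : Edge G} → (lo e , hi e) ≡ (lo e′ , hi e′) → e ≡ e′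
    edge-≡ refl = refl

  Fin↣Edge : Fin size ↣ Edge G
  Fin↣Edge = mk↣ {to = to} λ eq → lookup-injective (Unique.filter⁺ _ (Unique.cartesianProduct⁺ (Unique.allFin⁺ order) (Unique.allFin⁺ order)))
                                    (cong (λ e → lo e , hi e) eq)
    where
    pairs = filter (λ (u , v) → (u Fin.<? v) ×-dec adj? u v) (cartesianProduct (allFin order) (allFin order))
    to : Fin size → Edge G
    to i with (lt , a) ← proj₂ (∈-filter⁻ (λ (u , v) → (u Fin.<? v) ×-dec adj? u v) {xs = cartesianProduct (allFin order) (allFin order)} (∈-lookup {xs = pairs} i)) =
      mkEdge (proj₁ (lookup pairs i)) (proj₂ (lookup pairs i)) lt a

-- From a packing to a total labeling.

module Labeling {G : Graph} {E : Set} (enumeration : EdgeEnumeration G E)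
                {q : ℕ} (E↔Fin : E ↔ Fin q)
                {T : ℕ} (T≡ : T ≡ Graph.order G + q) (P : Packing (Vertex G ⊎ E) T) where
  open Graph G using (Adj; adj?; sym; order; size; edge)
  open EdgeEnumeration enumeration

  private
    decode : Edge G → E
    decode e = code (edge-adjacent e)

    edge-decode : ∀ e → edge (adjacent (decode e)) ≡ e
    edge-decode e = trans (edge-cong {G} (adjacent (decode e)) (edge-adjacent e) (ends (edge-adjacent e))) (edge-edge-adjacent e)

    decode-edge : ∀ {u v} (a : Adj u v) {e} → SamePair (src e) (tgt e) u v → decode (edge a) ≡ e
    decode-edge a {e} same = distinct (samePair-trans (ends (edge-adjacent (edge a)))
      (samePair-trans (edge-ends {G} a) (samePair-sym same)))

    decode-injective : Injective _≡_ _≡_ decode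
    decode-injective {x} {y} eq = trans (≡-sym (edge-decode x)) (trans (cong (λ e → edge (adjacent e)) eq) (edge-decode y))

    edge-injective : Injective _≡_ _≡_ (λ e → edge (adjacent e))
    edge-injective {x} {y} eq = trans (≡-sym (decode-edge (adjacent x) (inj₁ (refl , refl))))
      (trans (cong decode eq) (decode-edge (adjacent y) (inj₁ (refl , refl))))

    -- Injections in both directions give the equality, so the filtered list behind `size` never has
    -- to be counted.
    size≡q : q ≡ size
    size≡q = ℕ.≤-antisym
      (injective⇒≤ (λ eq → Injection.injective (↔⇒↣ (↔-sym E↔Fin)) (edge-injective (Injection.injective (Edge↣Fin {G}) eq))))
      (injective⇒≤ (λ eq → Injection.injective (Fin↣Edge {G}) (decode-injective (Injection.injective (↔⇒↣ E↔Fin) eq))))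

    T≡N : T ≡ order + size
    T≡N = trans T≡ (cong (order +_) size≡q)

    position : Vertex G ⊎ Edge G → ℕ
    position (inj₁ v) = at P (inj₁ v)
    position (inj₂ e) = at P (inj₂ (decode e))

    position<N : ∀ x → position x < order + size
    position<N (inj₁ v) = subst (position (inj₁ v) ℕ.<_) T≡N (at<n P (inj₁ v))
    position<N (inj₂ e) = subst (position (inj₂ e) ℕ.<_) T≡N (at<n P (inj₂ (decode e)))

    position-injective : Injective _≡_ _≡_ position
    position-injective {inj₁ v} {inj₁ w} eq with refl ← injective P eq = refl
    position-injective {inj₁ v} {inj₂ e} eq with () ← injective P eq
    position-injective {inj₂ e} {inj₁ v} eq with () ← injective P eq
    position-injective {inj₂ e} {inj₂ e′} eq = cong inj₂ (decode-injective (inj₂-injective (injective P eq)))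

    to : Vertex G ⊎ Edge G → Fin (order + size)
    to x = Fin.fromℕ< (position<N x)

    to-injective : Injective _≡_ _≡_ to
    to-injective eq = position-injective (fromℕ<-injective _ _ _ _ eq)

    from : Fin (order + size) → Vertex G ⊎ Edge G
    from i = Sum.map₂ (Injection.to (Fin↣Edge {G})) (splitAt order i)

    from-injective : Injective _≡_ _≡_ from
    from-injective {i} {j} eq = Injection.injective (↔⇒↣ +↔⊎) (map₂-injective eq)
      where
      map₂-injective : Injective _≡_ _≡_ (Sum.map₂ {A = Vertex G} (Injection.to (Fin↣Edge {G})))
      map₂-injective {inj₁ _} {inj₁ _} refl = refl
      map₂-injective {inj₂ _} {inj₂ _} eq = cong inj₂ (Injection.injective (Fin↣Edge {G}) (inj₂-injective eq))

  labeling : TotalLabeling G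
  -- `to ∘ from` is an injective self-map of a finite set, hence onto; a preimage under it is
  -- carried by `from` to a preimage under `to`.
  labeling = mk⤖ (to-injective , λ y → let (i , eq) = injective⇒surjective (from-injective ∘ to-injective) y in
    from i , λ { refl → eq })

  label-vertex : ∀ v → label {G} labeling (inj₁ v) ≡ suc (at P (inj₁ v))
  label-vertex v = cong suc (toℕ-fromℕ< (position<N (inj₁ v)))

  label-edge : ∀ {u v} (a : Adj u v) {e} → SamePair (src e) (tgt e) u v → label {G} labeling (inj₂ (edge a)) ≡ suc (at P (inj₂ e))
  label-edge a same = cong suc (trans (toℕ-fromℕ< (position<N (inj₂ (edge a)))) (cong (λ e → at P (inj₂ e)) (decode-edge a same)))

  contribution-edge : ∀ {u v} (d : Dec (Adj u v)) {e} → SamePair (src e) (tgt e) u v →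
                      contribution {G} labeling d ≡ suc (at P (inj₂ e)) + suc (at P (inj₁ v))
  contribution-edge (yes a) same = cong₂ _+_ (label-edge a same) (label-vertex _)
  contribution-edge (no ¬a) {e} (inj₁ (refl , refl)) = contradiction (adjacent e) ¬a
  contribution-edge (no ¬a) {e} (inj₂ (refl , refl)) = contradiction (sym (adjacent e)) ¬a

  contribution-none : ∀ {u v} (d : Dec (Adj u v)) → ¬ Adj u v → contribution {G} labeling d ≡ 0
  contribution-none (yes a) ¬a = contradiction a ¬a
  contribution-none (no _)  _  = refl

  f⁺-sum : ∀ u → f⁺ {G} labeling u ≡ sum λ x → contribution {G} labeling (adj? u x)
  f⁺-sum u = sum-allFin λ x → contribution {G} labeling (adj? u x)

-- Bounds on the number of colours.

module _ {G : Graph} (f : TotalLabeling G) where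
  open Graph G using (Adj; order)

  private
    ∈colors : ∀ v → f⁺ {G} f v ∈ deduplicate ℕ._≟_ (map (f⁺ {G} f) (allFin order))
    ∈colors v = ∈-deduplicate⁺ ℕ._≟_ (∈-map⁺ (f⁺ {G} f) (∈-allFin v))

  clique≤colorCount : ∀ {k} (K : Fin k → Vertex G) → (∀ {i j} → i ≢ j → Adj (K i) (K j)) → IsLTNA {G} f → k ≤ colorCount {G} f
  clique≤colorCount {k} K clique ltna = subst (_≤ colorCount {G} f) (length-tabulate colors)
    (Unique-⊆⇒length≤ (Unique.tabulate⁺ colors-injective) λ c∈ → let (i , eq) = ∈-tabulate⁻ c∈ in subst (_∈ _) (≡-sym eq) (∈colors (K i)))
    where
    colors : Fin k → ℕ
    colors i = f⁺ {G} f (K i)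
    colors-injective : ∀ {i j} → colors i ≡ colors j → i ≡ j
    colors-injective {i} {j} eq with i Fin.≟ j
    ... | yes i≡j = i≡j
    ... | no  i≢j = contradiction eq (ltna (clique i≢j))

  colorCount≤ : ∀ {k} (c : Fin k → ℕ) → (∀ v → ∃[ i ] f⁺ {G} f v ≡ c i) → colorCount {G} f ≤ k
  colorCount≤ c covered = subst (colorCount {G} f ≤_) (length-tabulate c)
    (Unique-⊆⇒length≤ (deduplicate-! (map (f⁺ {G} f) (allFin order))) λ x∈ →
      let (v , _ , eq) = ∈-map⁻ (f⁺ {G} f) (∈-deduplicate⁻ ℕ._≟_ (map (f⁺ {G} f) (allFin order)) x∈)
          (i , eq′) = covered v
      in subst (_∈ tabulate c) (≡-sym (trans eq eq′)) (∈-tabulate⁺ i))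

-- Edges of cycles, wheels and joins.

module _ {k : ℕ} .{{nz : NonZero k}} (3≤k : 3 ≤ k) where

  private
    2≤k : 2 ≤ k
    2≤k = ℕ.≤-trans (s≤s (s≤s z≤n)) 3≤k

    next-pair-injective : ∀ {i j : Fin k} → SamePair i (next i) j (next j) → i ≡ j
    next-pair-injective (inj₁ (eq , _)) = eq
    next-pair-injective (inj₂ (i≡ , j≡)) = contradiction (trans (cong next (≡-sym i≡)) j≡) (next²≢ 3≤k _)

  cycleEdges : EdgeEnumeration (C k) (Fin k)
  cycleEdges = record
    { src = id ; tgt = next
    ; adjacent = λ i → (λ eq → next≢ 2≤k i (≡-sym eq)) , related i
    ; code = λ { {u} {v} (_ , r) → code u v r }
    ; ends = λ { {u} {v} (_ , r) → ends u v r }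
    ; distinct = next-pair-injective
    }
    where
    R : Fin k → Fin k → Set
    R u v = (toℕ u ≡ 0 × suc (toℕ v) ≡ k) ⊎ suc (toℕ u) ≡ toℕ v
    related : ∀ i → R i (next i) ⊎ R (next i) i
    related i with nextView i
    ... | step _ p = inj₁ (inj₂ (≡-sym p))
    ... | wrap p q = inj₂ (inj₁ (q , p))
    code : ∀ u v → R u v ⊎ R v u → Fin k
    -- The closing edge is named after its end k - 1, whose `next` is 0, in line with all other
    -- edges.
    code u v (inj₁ (inj₁ _)) = v
    code u v (inj₁ (inj₂ _)) = u
    code u v (inj₂ (inj₁ _)) = u
    code u v (inj₂ (inj₂ _)) = v
    ends : ∀ u v (r : R u v ⊎ R v u) → SamePair (code u v r) (next (code u v r)) u v
    ends u v (inj₁ (inj₁ (p , q))) = inj₂ (refl , next-wrap q p)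
    ends u v (inj₁ (inj₂ p))       = inj₁ (refl , next-step p)
    ends u v (inj₂ (inj₁ (p , q))) = inj₁ (refl , next-wrap q p)
    ends u v (inj₂ (inj₂ p))       = inj₂ (refl , next-step p)

  wheelEdges : EdgeEnumeration (W k) (Fin k ⊎ Fin k)
  wheelEdges = record
    { src = src ; tgt = tgt
    ; adjacent = λ e → ends-differ e , related e
    ; code = λ { {u} {v} (_ , inj₁ r) → code u v r ; {u} {v} (_ , inj₂ r) → code v u r }
    ; ends = λ { {u} {v} (_ , inj₁ r) → ends u v r
               ; {u} {v} (_ , inj₂ r) → samePair-trans (ends v u r) (inj₂ (refl , refl)) }
    ; distinct = λ {e} {e′} → distinct {e} {e′}
    }
    where
    R : Fin (k + 1) → Fin (k + 1) → Set
    R u v = (toℕ u ≡ 0 × suc (toℕ v) ≡ k) ⊎ (suc (toℕ u) ≡ toℕ v × toℕ v < k) ⊎ (toℕ u < k × toℕ v ≡ k)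
    rim : Fin k → Fin (k + 1)
    rim j = j ↑ˡ 1
    hub : Fin (k + 1)
    hub = k ↑ʳ 0F
    toℕ-hub : toℕ hub ≡ k
    toℕ-hub = trans (toℕ-↑ʳ k 0F) (ℕ.+-identityʳ k)
    rim≢hub : ∀ {j} → rim j ≢ hub
    rim≢hub {j} = ↑ˡ≢↑ʳ j 0F
    rim-fromℕ< : ∀ {u} (u<k : toℕ u < k) → rim (fromℕ< u<k) ≡ u
    rim-fromℕ< u<k = toℕ-injective (trans (toℕ-↑ˡ _ 1) (toℕ-fromℕ< u<k))
    src tgt : Fin k ⊎ Fin k → Fin (k + 1)
    src (inj₁ j) = rim j
    src (inj₂ j) = rim j
    tgt (inj₁ j) = rim (next j)
    tgt (inj₂ j) = hub
    ends-differ : ∀ e → src e ≢ tgt e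
    ends-differ (inj₁ j) eq = next≢ 2≤k j (≡-sym (↑ˡ-injective 1 j (next j) eq))
    ends-differ (inj₂ j) = rim≢hub
    related : ∀ e → R (src e) (tgt e) ⊎ R (tgt e) (src e)
    related (inj₁ j) with nextView j
    ... | step p q rewrite toℕ-↑ˡ j 1 | toℕ-↑ˡ (next j) 1 = inj₁ (inj₂ (inj₁ (≡-sym q , subst (ℕ._< k) (≡-sym q) p)))
    ... | wrap p q rewrite toℕ-↑ˡ j 1 | toℕ-↑ˡ (next j) 1 = inj₂ (inj₁ (q , p))
    related (inj₂ j) = inj₁ (inj₂ (inj₂ (subst (ℕ._< k) (≡-sym (toℕ-↑ˡ j 1)) (toℕ<n j) , toℕ-hub)))
    code : ∀ u v → R u v → Fin k ⊎ Fin k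
    code u v (inj₁ (_ , sv≡k))               = inj₁ (fromℕ< (ℕ.≤-reflexive sv≡k))
    code u v (inj₂ (inj₁ (su≡v , v<k)))      = inj₁ (fromℕ< (ℕ.≤-trans (ℕ.≤-reflexive su≡v) (ℕ.<⇒≤ v<k)))
    code u v (inj₂ (inj₂ (u<k , _)))         = inj₂ (fromℕ< u<k)
    ends : ∀ u v (r : R u v) → SamePair (src (code u v r)) (tgt (code u v r)) u v
    ends u v (inj₁ (u≡0 , sv≡k)) = inj₂ (rim-fromℕ< v<k , trans (cong rim wraps) (rim-fromℕ< u<k))
      where
      v<k = ℕ.≤-reflexive sv≡k
      u<k : toℕ u < k
      u<k = subst (ℕ._< k) (≡-sym u≡0) (ℕ.<⇒≤ 2≤k)
      wraps : next (fromℕ< v<k) ≡ fromℕ< u<k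
      wraps = next-wrap (trans (cong suc (toℕ-fromℕ< v<k)) sv≡k) (trans (toℕ-fromℕ< u<k) u≡0)
    ends u v (inj₂ (inj₁ (su≡v , v<k))) = inj₁ (rim-fromℕ< u<k , trans (cong rim steps) (rim-fromℕ< v<k))
      where
      u<k = ℕ.≤-trans (ℕ.≤-reflexive su≡v) (ℕ.<⇒≤ v<k)
      steps : next (fromℕ< u<k) ≡ fromℕ< v<k
      steps = next-step (trans (cong suc (toℕ-fromℕ< u<k)) (trans su≡v (≡-sym (toℕ-fromℕ< v<k))))
    ends u v (inj₂ (inj₂ (u<k , v≡k))) = inj₁ (rim-fromℕ< u<k , toℕ-injective (trans toℕ-hub (≡-sym v≡k)))
    distinct : ∀ {e e′} → SamePair (src e) (tgt e) (src e′) (tgt e′) → e ≡ e′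
    distinct {inj₁ i} {inj₁ j} same = cong inj₁ (next-pair-injective (samePair-map⁻ (λ {x} {y} → ↑ˡ-injective 1 x y) same))
    distinct {inj₁ i} {inj₂ j} (inj₁ (_ , eq)) = contradiction eq rim≢hub
    distinct {inj₁ i} {inj₂ j} (inj₂ (eq , _)) = contradiction eq rim≢hub
    distinct {inj₂ i} {inj₁ j} (inj₁ (_ , eq)) = contradiction (≡-sym eq) rim≢hub
    distinct {inj₂ i} {inj₁ j} (inj₂ (_ , eq)) = contradiction (≡-sym eq) rim≢hub
    distinct {inj₂ i} {inj₂ j} (inj₁ (eq , _)) = cong inj₂ (↑ˡ-injective 1 i j eq)
    distinct {inj₂ i} {inj₂ j} (inj₂ (eq , _)) = contradiction eq rim≢hub

joinEdges : ∀ {G H : Graph} {E F : Set} → EdgeEnumeration G E → EdgeEnumeration H F → EdgeEnumeration (G ∨ H) (E ⊎ F ⊎ (Vertex G × Vertex H))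
joinEdges {G} {H} {E} {F} EG EH = record
  { src = unsplit ∘ src ; tgt = unsplit ∘ tgt
  ; adjacent = λ e → subst₂ (JoinAdj G H) (≡-sym (split-unsplit (src e))) (≡-sym (split-unsplit (tgt e))) (adjacent e)
  ; code = λ {u} {v} → code (splitAt m u) (splitAt m v)
  ; ends = λ {u} {v} a → subst₂ (SamePair _ _) (join-splitAt m n u) (join-splitAt m n v) (samePair-map unsplit (ends (splitAt m u) (splitAt m v) a))
  ; distinct = λ {e} {e′} → distinct {e} {e′} ∘ samePair-map⁻ unsplit-injective
  }
  where
  module EG = EdgeEnumeration EG
  module EH = EdgeEnumeration EH
  m = Graph.order G
  n = Graph.order H
  unsplit : Vertex G ⊎ Vertex H → Fin (m + n)
  unsplit = join m n
  split-unsplit = splitAt-join m n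
  unsplit-injective : Injective _≡_ _≡_ unsplit
  unsplit-injective {x} {y} eq = trans (≡-sym (split-unsplit x)) (trans (cong (splitAt m) eq) (split-unsplit y))
  src tgt : E ⊎ F ⊎ (Vertex G × Vertex H) → Vertex G ⊎ Vertex H
  src (inj₁ e)              = inj₁ (EG.src e)
  src (inj₂ (inj₁ e))       = inj₂ (EH.src e)
  src (inj₂ (inj₂ (u , _))) = inj₁ u
  tgt (inj₁ e)              = inj₁ (EG.tgt e)
  tgt (inj₂ (inj₁ e))       = inj₂ (EH.tgt e)
  tgt (inj₂ (inj₂ (_ , v))) = inj₂ v
  adjacent : ∀ e → JoinAdj G H (src e) (tgt e)
  adjacent (inj₁ e)        = EG.adjacent e
  adjacent (inj₂ (inj₁ e)) = EH.adjacent e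
  adjacent (inj₂ (inj₂ _)) = tt
  code : ∀ x y → JoinAdj G H x y → E ⊎ F ⊎ (Vertex G × Vertex H)
  code (inj₁ u) (inj₁ v) a = inj₁ (EG.code a)
  code (inj₁ u) (inj₂ v) _ = inj₂ (inj₂ (u , v))
  code (inj₂ v) (inj₁ u) _ = inj₂ (inj₂ (u , v))
  code (inj₂ u) (inj₂ v) a = inj₂ (inj₁ (EH.code a))
  ends : ∀ x y (a : JoinAdj G H x y) → SamePair (src (code x y a)) (tgt (code x y a)) x y
  ends (inj₁ u) (inj₁ v) a = samePair-map inj₁ (EG.ends a)
  ends (inj₁ u) (inj₂ v) _ = inj₁ (refl , refl)
  ends (inj₂ v) (inj₁ u) _ = inj₂ (refl , refl)
  ends (inj₂ u) (inj₂ v) a = samePair-map inj₂ (EH.ends a)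
  distinct : ∀ {e e′} → SamePair (src e) (tgt e) (src e′) (tgt e′) → e ≡ e′
  distinct {inj₁ _} {inj₁ _} same = cong inj₁ (EG.distinct (samePair-map⁻ inj₁-injective same))
  distinct {inj₂ (inj₁ _)} {inj₂ (inj₁ _)} same = cong (inj₂ ∘ inj₁) (EH.distinct (samePair-map⁻ inj₂-injective same))
  distinct {inj₂ (inj₂ _)} {inj₂ (inj₂ _)} (inj₁ (refl , refl)) = refl
  distinct {inj₁ _} {inj₂ (inj₁ _)} (inj₁ (() , _))
  distinct {inj₁ _} {inj₂ (inj₁ _)} (inj₂ (() , _))
  distinct {inj₁ _} {inj₂ (inj₂ _)} (inj₁ (_ , ()))
  distinct {inj₁ _} {inj₂ (inj₂ _)} (inj₂ (() , _))
  distinct {inj₂ (inj₁ _)} {inj₁ _} (inj₁ (() , _))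
  distinct {inj₂ (inj₁ _)} {inj₁ _} (inj₂ (() , _))
  distinct {inj₂ (inj₁ _)} {inj₂ (inj₂ _)} (inj₁ (() , _))
  distinct {inj₂ (inj₁ _)} {inj₂ (inj₂ _)} (inj₂ (_ , ()))
  distinct {inj₂ (inj₂ _)} {inj₁ _} (inj₁ (_ , ()))
  distinct {inj₂ (inj₂ _)} {inj₁ _} (inj₂ (_ , ()))
  distinct {inj₂ (inj₂ _)} {inj₂ (inj₁ _)} (inj₁ (() , _))
  distinct {inj₂ (inj₂ _)} {inj₂ (inj₁ _)} (inj₂ (() , _))

-- The join of a cycle and a wheel.

JoinEdge : ℕ → ℕ → Set
JoinEdge m k = Fin m ⊎ (Fin k ⊎ Fin k) ⊎ (Fin m × Fin (k + 1))

joinSize : ℕ → ℕ → ℕ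
joinSize m k = m + ((k + k) + m * (k + 1))

JoinEdge↔Fin : ∀ m k → JoinEdge m k ↔ Fin (joinSize m k)
JoinEdge↔Fin m k = ↔-sym (↔-trans +↔⊎ (↔-id _ ⊎-↔ ↔-trans +↔⊎ (+↔⊎ ⊎-↔ *↔×)))

module CycleWheel {m k : ℕ} .{{_ : NonZero m}} .{{_ : NonZero k}} (3≤m : 3 ≤ m) (3≤k : 3 ≤ k) where

  open Graph (C m ∨ W k) using (Adj; sym)

  edges : EdgeEnumeration (C m ∨ W k) (JoinEdge m k)
  edges = joinEdges (cycleEdges 3≤m) (wheelEdges 3≤k)

  open EdgeEnumeration edges

  cyc : Fin m → Vertex (C m ∨ W k)
  cyc i = i ↑ˡ (k + 1)

  rim : Fin k → Vertex (C m ∨ W k)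
  rim j = m ↑ʳ (j ↑ˡ 1)

  hub : Vertex (C m ∨ W k)
  hub = m ↑ʳ (k ↑ʳ 0F)

  private
    data WheelView : Fin (k + 1) → Set where
      isRim : ∀ j → WheelView (j ↑ˡ 1)
      isHub : WheelView (k ↑ʳ 0F)

    wheelView : ∀ v → WheelView v
    wheelView v with splitAt k v | join-splitAt k 1 v
    ... | inj₁ j  | refl = isRim j
    ... | inj₂ 0F | refl = isHub

  vertex-elim : ∀ (Q : Vertex (C m ∨ W k) → Set) → (∀ i → Q (cyc i)) → (∀ j → Q (rim j)) → Q hub → ∀ v → Q v
  vertex-elim Q qc qr qh v with splitAt m v | join-splitAt m (k + 1) v
  ... | inj₁ i | refl = qc i
  ... | inj₂ w | refl with wheelView w
  ...   | isRim j = qr j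
  ...   | isHub   = qh

  cyc-cyc : ∀ i → Adj (cyc i) (cyc (next i))
  cyc-cyc i = adjacent (inj₁ i)

  rim-rim : ∀ j → Adj (rim j) (rim (next j))
  rim-rim j = adjacent (inj₂ (inj₁ (inj₁ j)))

  rim-hub : ∀ j → Adj (rim j) hub
  rim-hub j = adjacent (inj₂ (inj₁ (inj₂ j)))

  cyc-rim : ∀ i j → Adj (cyc i) (rim j)
  cyc-rim i j = adjacent (inj₂ (inj₂ (i , j ↑ˡ 1)))

  cyc-hub : ∀ i → Adj (cyc i) hub
  cyc-hub i = adjacent (inj₂ (inj₂ (i , k ↑ʳ 0F)))

  module _ (f : Vertex (C m ∨ W k) → ℕ)
           (cyc≢cyc : ∀ i → f (cyc i) ≢ f (cyc (next i))) (rim≢rim : ∀ j → f (rim j) ≢ f (rim (next j)))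
           (rim≢hub : ∀ j → f (rim j) ≢ f hub) (cyc≢rim : ∀ i j → f (cyc i) ≢ f (rim j)) (cyc≢hub : ∀ i → f (cyc i) ≢ f hub) where

    private
      proper-edge : ∀ e → f (src e) ≢ f (tgt e)
      proper-edge (inj₁ i)               = cyc≢cyc i
      proper-edge (inj₂ (inj₁ (inj₁ j))) = rim≢rim j
      proper-edge (inj₂ (inj₁ (inj₂ j))) = rim≢hub j
      proper-edge (inj₂ (inj₂ (i , v))) with wheelView v
      ... | isRim j = cyc≢rim i j
      ... | isHub   = cyc≢hub i

    proper : ∀ {u v} → Adj u v → f u ≢ f v
    proper a with code a | ends a
    ... | e | inj₁ (refl , refl) = proper-edge e
    ... | e | inj₂ (refl , refl) = ≢-sym (proper-edge e)

  private
    i₀ : Fin m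
    i₀ = fromℕ< (ℕ.<⇒≤ (ℕ.<⇒≤ 3≤m))

    j₀ : Fin k
    j₀ = fromℕ< (ℕ.<⇒≤ (ℕ.<⇒≤ 3≤k))

    K₅ : Fin 5 → Vertex (C m ∨ W k)
    K₅ 0F = cyc i₀
    K₅ 1F = cyc (next i₀)
    K₅ 2F = rim j₀
    K₅ 3F = rim (next j₀)
    K₅ 4F = hub

    K₅-increasing : ∀ {i j} → i Fin.< j → Adj (K₅ i) (K₅ j)
    K₅-increasing {0F} {1F} _ = cyc-cyc i₀
    K₅-increasing {0F} {2F} _ = cyc-rim i₀ j₀
    K₅-increasing {0F} {3F} _ = cyc-rim i₀ (next j₀)
    K₅-increasing {0F} {4F} _ = cyc-hub i₀
    K₅-increasing {1F} {2F} _ = cyc-rim (next i₀) j₀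
    K₅-increasing {1F} {3F} _ = cyc-rim (next i₀) (next j₀)
    K₅-increasing {1F} {4F} _ = cyc-hub (next i₀)
    K₅-increasing {2F} {3F} _ = rim-rim j₀
    K₅-increasing {2F} {4F} _ = rim-hub j₀
    K₅-increasing {3F} {4F} _ = rim-hub (next j₀)
    K₅-increasing {1F} {1F} (s≤s ())
    K₅-increasing {2F} {1F} (s≤s ())
    K₅-increasing {2F} {2F} (s≤s (s≤s ()))
    K₅-increasing {3F} {1F} (s≤s ())
    K₅-increasing {3F} {2F} (s≤s (s≤s ()))
    K₅-increasing {3F} {3F} (s≤s (s≤s (s≤s ())))
    K₅-increasing {4F} {1F} (s≤s ())
    K₅-increasing {4F} {2F} (s≤s (s≤s ()))
    K₅-increasing {4F} {3F} (s≤s (s≤s (s≤s ())))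
    K₅-increasing {4F} {4F} (s≤s (s≤s (s≤s (s≤s ()))))

    K₅-clique : ∀ {i j} → i ≢ j → Adj (K₅ i) (K₅ j)
    K₅-clique {i} {j} i≢j with Fin.<-cmp i j
    ... | tri< i<j _ _ = K₅-increasing i<j
    ... | tri≈ _ i≡j _ = contradiction i≡j i≢j
    ... | tri> _ _ j<i = sym {K₅ j} {K₅ i} (K₅-increasing j<i)

  noIsolatedVertices : NoIsolatedVertices (C m ∨ W k)
  noIsolatedVertices = vertex-elim (λ u → ∃[ v ] Adj u v)
    (λ i → hub , cyc-hub i) (λ j → hub , rim-hub j) (cyc i₀ , sym {cyc i₀} {hub} (cyc-hub i₀))

  5≤colorCount : ∀ g → IsLTNA {C m ∨ W k} g → 5 ≤ colorCount {C m ∨ W k} g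
  5≤colorCount g = clique≤colorCount {C m ∨ W k} g K₅ K₅-clique

  χltna≡5 : ∀ g → IsLTNA {C m ∨ W k} g → (c : Fin 5 → ℕ) → (∀ v → ∃[ i ] f⁺ {C m ∨ W k} g v ≡ c i) → χltna (C m ∨ W k) ≡ 5
  χltna≡5 g ltna c covered = record
    { noIsolated = noIsolatedVertices
    ; attained   = g , (λ {u} {v} → ltna {u} {v}) , ℕ.≤-antisym (colorCount≤ {C m ∨ W k} g c covered) (5≤colorCount g ltna)
    ; minimal    = 5≤colorCount
    }

-- Induced colours as sums of labels.

module InducedColours {m k : ℕ} .{{_ : NonZero m}} .{{_ : NonZero k}} (3≤m : 3 ≤ m) (3≤k : 3 ≤ k)
  {T : ℕ} (T≡ : T ≡ Graph.order (C m ∨ W k) + joinSize m k)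
  (P : Packing (Vertex (C m ∨ W k) ⊎ JoinEdge m k) T) where

  open Graph (C m ∨ W k) using (Adj; adj?)

  open CycleWheel 3≤m 3≤k public using (edges; cyc; rim; hub)
  open Labeling edges (JoinEdge↔Fin m k) T≡ P public

  vertexLabel : Vertex (C m ∨ W k) → ℕ
  vertexLabel v = suc (at P (inj₁ v))

  cycEdgeLabel cycHubLabel : Fin m → ℕ
  cycEdgeLabel i = suc (at P (inj₂ (inj₁ i)))
  cycHubLabel i  = suc (at P (inj₂ (inj₂ (inj₂ (i , k ↑ʳ 0F)))))

  rimEdgeLabel spokeLabel : Fin k → ℕ
  rimEdgeLabel j = suc (at P (inj₂ (inj₂ (inj₁ (inj₁ j)))))
  spokeLabel j   = suc (at P (inj₂ (inj₂ (inj₁ (inj₂ j)))))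

  crossLabel : Fin m → Fin k → ℕ
  crossLabel i j = suc (at P (inj₂ (inj₂ (inj₂ (i , j ↑ˡ 1)))))

  private
    φ : Vertex (C m ∨ W k) → Vertex (C m ∨ W k) → ℕ
    φ u x = contribution {C m ∨ W k} labeling (adj? u x)

    f⁺-split : ∀ u → f⁺ {C m ∨ W k} labeling u ≡ sum (φ u ∘ cyc) + (sum (φ u ∘ rim) + φ u hub)
    f⁺-split u = trans (f⁺-sum u) (trans (sum-↑ m (φ u)) (cong (sum (φ u ∘ cyc) +_)
      (trans (sum-↑ k (φ u ∘ (m ↑ʳ_))) (cong (sum (φ u ∘ rim) +_) (ℕ.+-identityʳ _)))))

    cyc-adj : ∀ {i j} → Adj (cyc i) (cyc j) → ∃[ e ] SamePair e (next e) i j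
    cyc-adj {i} {j} a = EdgeEnumeration.code (cycleEdges 3≤m) a′ , EdgeEnumeration.ends (cycleEdges 3≤m) a′
      where a′ = subst₂ (JoinAdj (C m) (W k)) (splitAt-↑ˡ m i (k + 1)) (splitAt-↑ˡ m j (k + 1)) a

    rim-adj : ∀ {i j} → Adj (rim i) (rim j) → ∃[ e ] SamePair e (next e) i j
    rim-adj {i} {j} a with EdgeEnumeration.code (wheelEdges 3≤k) a′ | EdgeEnumeration.ends (wheelEdges 3≤k) a′
      where a′ = subst₂ (JoinAdj (C m) (W k)) (splitAt-↑ʳ m (k + 1) (i ↑ˡ 1)) (splitAt-↑ʳ m (k + 1) (j ↑ˡ 1)) a
    ... | inj₁ e | same = e , samePair-map⁻ (λ {x} {y} → ↑ˡ-injective 1 x y) same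
    ... | inj₂ e | inj₁ (_ , eq) = contradiction (≡-sym eq) (↑ˡ≢↑ʳ j 0F)
    ... | inj₂ e | inj₂ (_ , eq) = contradiction (≡-sym eq) (↑ˡ≢↑ʳ i 0F)

    cyclic-neighbour : ∀ {n} .{{_ : NonZero n}} {i j : Fin n} → ∃[ e ] SamePair e (next e) (next i) j → (j ≡ i) ⊎ (j ≡ next (next i))
    cyclic-neighbour (e , inj₁ (refl , eq)) = inj₂ (≡-sym eq)
    cyclic-neighbour (e , inj₂ (refl , eq)) = inj₁ (next-injective eq)

    -- Stated at `next i`, whose neighbours are then `i` and `next (next i)`, so that no inverse of
    -- `next` occurs.
    cyc-sum : ∀ i → sum (φ (cyc (next i)) ∘ cyc) ≡
              (cycEdgeLabel i + vertexLabel (cyc i)) + (cycEdgeLabel (next i) + vertexLabel (cyc (next (next i))))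
    cyc-sum i = trans
      (sum-pair (φ (cyc (next i)) ∘ cyc) i (next (next i)) (λ eq → next²≢ 3≤m i (≡-sym eq))
        λ j j≢i j≢i″ → contribution-none (adj? (cyc (next i)) (cyc j)) λ a → Sum.[ j≢i , j≢i″ ]′ (cyclic-neighbour (cyc-adj a)))
      (cong₂ _+_ (contribution-edge (adj? _ _) {inj₁ i} (inj₂ (refl , refl)))
                 (contribution-edge (adj? _ _) {inj₁ (next i)} (inj₁ (refl , refl))))

    rim-sum : ∀ j → sum (φ (rim (next j)) ∘ rim) ≡
              (rimEdgeLabel j + vertexLabel (rim j)) + (rimEdgeLabel (next j) + vertexLabel (rim (next (next j))))
    rim-sum j = trans
      (sum-pair (φ (rim (next j)) ∘ rim) j (next (next j)) (λ eq → next²≢ 3≤k j (≡-sym eq))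
        λ i i≢j i≢j″ → contribution-none (adj? (rim (next j)) (rim i)) λ a → Sum.[ i≢j , i≢j″ ]′ (cyclic-neighbour (rim-adj a)))
      (cong₂ _+_ (contribution-edge (adj? _ _) {inj₂ (inj₁ (inj₁ j))} (inj₂ (refl , refl)))
                 (contribution-edge (adj? _ _) {inj₂ (inj₁ (inj₁ (next j)))} (inj₁ (refl , refl))))

  -- The neighbours enter through equations, so that they can be supplied in split form as
  -- `combine a ε`, for which the label formulas are available.
  f⁺-cyc : ∀ (i : Fin m) {j l : Fin m} → next i ≡ j → next j ≡ l → f⁺ {C m ∨ W k} labeling (cyc j) ≡
           ((cycEdgeLabel i + vertexLabel (cyc i)) + (cycEdgeLabel j + vertexLabel (cyc l)))
         + (sum (crossLabel j) + sum (vertexLabel ∘ rim) + (cycHubLabel j + vertexLabel hub))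
  f⁺-cyc i refl refl = trans (f⁺-split (cyc (next i))) (cong₂ _+_ (cyc-sum i) (cong₂ _+_
    (trans (sum-cong-≗ λ j → contribution-edge (adj? (cyc (next i)) (rim j)) {inj₂ (inj₂ (next i , j ↑ˡ 1))} (inj₁ (refl , refl)))
           (∑-distrib-+ (crossLabel (next i)) (vertexLabel ∘ rim)))
    (contribution-edge (adj? (cyc (next i)) hub) {inj₂ (inj₂ (next i , k ↑ʳ 0F))} (inj₁ (refl , refl)))))

  f⁺-rim : ∀ (i : Fin k) {j l : Fin k} → next i ≡ j → next j ≡ l → f⁺ {C m ∨ W k} labeling (rim j) ≡
           sum (λ u → crossLabel u j) + sum (vertexLabel ∘ cyc)
         + (((rimEdgeLabel i + vertexLabel (rim i)) + (rimEdgeLabel j + vertexLabel (rim l))) + (spokeLabel j + vertexLabel hub))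
  f⁺-rim j refl refl = trans (f⁺-split (rim (next j))) (cong₂ _+_
    (trans (sum-cong-≗ λ i → contribution-edge (adj? (rim (next j)) (cyc i)) {inj₂ (inj₂ (i , next j ↑ˡ 1))} (inj₂ (refl , refl)))
           (∑-distrib-+ (λ i → crossLabel i (next j)) (vertexLabel ∘ cyc)))
    (cong₂ _+_ (rim-sum j)
      (contribution-edge (adj? (rim (next j)) hub) {inj₂ (inj₁ (inj₂ (next j)))} (inj₁ (refl , refl)))))

  f⁺-hub : f⁺ {C m ∨ W k} labeling hub ≡
           (sum cycHubLabel + sum (vertexLabel ∘ cyc)) + (sum spokeLabel + sum (vertexLabel ∘ rim))
  f⁺-hub = trans (f⁺-split hub) (cong₂ _+_
    (trans (sum-cong-≗ λ i → contribution-edge (adj? hub (cyc i)) {inj₂ (inj₂ (i , k ↑ʳ 0F))} (inj₂ (refl , refl)))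
           (∑-distrib-+ cycHubLabel (vertexLabel ∘ cyc)))
    (trans (cong₂ _+_
      (trans (sum-cong-≗ λ j → contribution-edge (adj? hub (rim j)) {inj₂ (inj₁ (inj₂ j))} (inj₂ (refl , refl)))
             (∑-distrib-+ spokeLabel (vertexLabel ∘ rim)))
      (contribution-none (adj? hub hub) (λ a → Graph.irrefl (C m ∨ W k) {hub} a))) (ℕ.+-identityʳ _)))

-- Sums over permuted blocks, and division by 2 modulo an odd number.

sum-shift : ∀ {n} c {g : Fin n → Fin n} → Injective _≡_ _≡_ g → sum (λ i → suc (c + toℕ (g i))) ≡ n * suc c + triangular n
sum-shift {n} c {g} inj = begin
  sum (λ i → suc c + toℕ (g i))               ≡⟨ ∑-distrib-+ (λ _ → suc c) (toℕ ∘ g) ⟩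
  sum {n} (λ _ → suc c) + sum (toℕ ∘ g)       ≡⟨ cong₂ _+_ (sum-const n (suc c)) (≡-sym (sum-permute toℕ (injective⇒permutation g inj))) ⟩
  n * suc c + triangular n                      ∎

sum-∘ : ∀ {n} (f : Fin n → ℕ) {g : Fin n → Fin n} → Injective _≡_ _≡_ g → sum (f ∘ g) ≡ sum f
sum-∘ f {g} inj = ≡-sym (sum-permute f (injective⇒permutation g inj))

-- Division by 2 modulo 2n + 1, the inverse of a ↦ 2a: as h(a + 1) = h(a) + n + 1, the sums
-- h(a) + h(a + 1) run through consecutive integers.

halve : ℕ → ℕ → ℕ
halve n zero          = 0
halve n (suc zero)    = suc n
halve n (suc (suc a)) = suc (halve n a)

halve-consecutive : ∀ n a → halve n a + halve n (suc a) ≡ n + suc a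
halve-consecutive n zero          = ℕ.+-comm 1 n
halve-consecutive n (suc zero)    = lem n where
  lem : ∀ n → suc n + 1 ≡ n + 2
  lem = solve-∀
halve-consecutive n (suc (suc a)) = begin
  suc (halve n a) + suc (halve n (suc a)) ≡⟨ cong suc (ℕ.+-suc _ _) ⟩
  2 + (halve n a + halve n (suc a))       ≡⟨ cong (2 +_) (halve-consecutive n a) ⟩
  2 + (n + suc a)                         ≡⟨ lem n a ⟩
  n + suc (suc (suc a))                   ∎
  where
  lem : ∀ n a → 2 + (n + suc a) ≡ n + suc (suc (suc a))
  lem = solve-∀

halve-even : ∀ n b → halve n (b + b) ≡ b
halve-even n zero    = refl
halve-even n (suc b) rewrite ℕ.+-suc b b = cong suc (halve-even n b)

-- The recursion adds 2 to both sides, and the base case 1 gives 2n + 2 = 1 + r. Both the range and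
-- the injectivity of `zigzag` come from this.
halve-double : ∀ n a → halve n a + halve n a ≡ a ⊎ halve n a + halve n a ≡ a + suc (n + n)
halve-double n zero          = inj₁ refl
halve-double n (suc zero)    = inj₂ (cong suc (ℕ.+-suc n n))
halve-double n (suc (suc a)) = Sum.map (λ eq → trans (cong suc (ℕ.+-suc _ _)) (cong (2 +_) eq))
                                       (λ eq → trans (cong suc (ℕ.+-suc _ _)) (cong (2 +_) eq)) (halve-double n a)

module _ (n : ℕ) where

  private
    r : ℕ
    r = suc (n + n)

    halve<r : ∀ (a : Fin r) → halve n (toℕ a) < r
    -- If r ≤ h, then 2r ≤ 2h ≤ a + r, against a < r.
    halve<r a = ℕ.≰⇒> λ r≤h → ℕ.<⇒≱ (ℕ.+-monoˡ-< r (toℕ<n a)) (ℕ.≤-trans (ℕ.+-mono-≤ r≤h r≤h) (bound (halve-double n (toℕ a))))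
      where
      bound : ∀ {h} → h ≡ toℕ a ⊎ h ≡ toℕ a + r → h ≤ toℕ a + r
      bound (inj₁ refl) = ℕ.m≤m+n (toℕ a) r
      bound (inj₂ refl) = ℕ.≤-refl

  zigzag : Fin r → Fin r
  zigzag a = fromℕ< (halve<r a)

  toℕ-zigzag : ∀ a → toℕ (zigzag a) ≡ halve n (toℕ a)
  toℕ-zigzag a = toℕ-fromℕ< (halve<r a)

  zigzag-injective : Injective _≡_ _≡_ zigzag
  zigzag-injective {a} {b} eq = toℕ-injective (compare (halve-double n (toℕ a)) (halve-double n (toℕ b)))
    where
    h≡ : halve n (toℕ a) + halve n (toℕ a) ≡ halve n (toℕ b) + halve n (toℕ b)
    h≡ = cong (λ h → h + h) (fromℕ<-injective _ _ _ _ eq)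
    too-large : ∀ (x y : Fin r) → toℕ x ≢ toℕ y + r
    too-large x y p = ℕ.<⇒≢ (ℕ.<-≤-trans (toℕ<n x) (ℕ.m≤n+m r (toℕ y))) p
    compare : halve n (toℕ a) + halve n (toℕ a) ≡ toℕ a ⊎ halve n (toℕ a) + halve n (toℕ a) ≡ toℕ a + r →
              halve n (toℕ b) + halve n (toℕ b) ≡ toℕ b ⊎ halve n (toℕ b) + halve n (toℕ b) ≡ toℕ b + r → toℕ a ≡ toℕ b
    compare (inj₁ p) (inj₁ q) = trans (≡-sym p) (trans h≡ q)
    compare (inj₁ p) (inj₂ q) = contradiction (trans (≡-sym p) (trans h≡ q)) (too-large a b)
    compare (inj₂ p) (inj₁ q) = contradiction (trans (≡-sym q) (trans (≡-sym h≡) p)) (too-large b a)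
    compare (inj₂ p) (inj₂ q) = ℕ.+-cancelʳ-≡ r _ _ (trans (≡-sym p) (trans h≡ q))

  -- At the wrap a = 2n the two halves are n and 0, and their sum still fits the formula because
  -- `next a` is 0.
  zigzag-next : ∀ (a : Fin r) → toℕ (zigzag a) + toℕ (zigzag (next a)) ≡ n + toℕ (next a)
  zigzag-next a = trans (cong₂ _+_ (toℕ-zigzag a) (toℕ-zigzag (next a))) (consecutive (nextView a))
    where
    consecutive : NextView a → halve n (toℕ a) + halve n (toℕ (next a)) ≡ n + toℕ (next a)
    consecutive (step _ p) = subst (λ x → halve n (toℕ a) + halve n x ≡ n + x) (≡-sym p) (halve-consecutive n (toℕ a))
    consecutive (wrap p q) = subst₂ (λ x y → halve n x + halve n y ≡ n + y) (≡-sym (ℕ.suc-injective p)) (≡-sym q) (cong (_+ 0) (halve-even n n))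

-- The cyclic successor on indices split by parity.

next-combine₀ : ∀ {l} .{{_ : NonZero l}} .{{_ : NonZero (l * 2)}} (a : Fin l) → next (combine a 0F) ≡ combine a 1F
next-combine₀ a = next-step (begin
  suc (toℕ (combine a 0F)) ≡⟨ cong suc (toℕ-combine a 0F) ⟩
  suc (2 * toℕ a + 0)      ≡⟨ ℕ.+-suc (2 * toℕ a) 0 ⟨
  2 * toℕ a + 1            ≡⟨ toℕ-combine a 1F ⟨
  toℕ (combine a 1F)       ∎)

next-combine₁ : ∀ {l} .{{_ : NonZero l}} .{{_ : NonZero (l * 2)}} (a : Fin l) → next (combine a 1F) ≡ combine (next a) 0F
next-combine₁ {l} a with nextView a
... | step _ p = next-step (begin
  suc (toℕ (combine a 1F))   ≡⟨ cong suc (toℕ-combine a 1F) ⟩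
  suc (2 * toℕ a + 1)        ≡⟨ lem (toℕ a) ⟩
  2 * suc (toℕ a) + 0        ≡⟨ cong (λ x → 2 * x + 0) p ⟨
  2 * toℕ (next a) + 0       ≡⟨ toℕ-combine (next a) 0F ⟨
  toℕ (combine (next a) 0F)  ∎)
  where
  lem : ∀ a → suc (2 * a + 1) ≡ 2 * suc a + 0
  lem = solve-∀
... | wrap p q = next-wrap (begin
  suc (toℕ (combine a 1F))   ≡⟨ cong suc (toℕ-combine a 1F) ⟩
  suc (2 * toℕ a + 1)        ≡⟨ lem (toℕ a) ⟩
  suc (toℕ a) * 2            ≡⟨ cong (_* 2) p ⟩
  l * 2                      ∎)
  (begin
  toℕ (combine (next a) 0F)  ≡⟨ toℕ-combine (next a) 0F ⟩
  2 * toℕ (next a) + 0       ≡⟨ cong (λ x → 2 * x + 0) q ⟩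
  0                          ∎)
  where
  lem : ∀ a → suc (2 * a + 1) ≡ suc a * 2
  lem = solve-∀

-- The labeling.

module Design (n s : ℕ) (1≤n : 1 ≤ n) (2≤s : 2 ≤ s) where

  -- The factor 2 stands on the right in `m` and `k` because `combine a ε` is then the index 2a + ε.
  -- `L` is half the number of cross edges, one for each `Cell`.
  r m k L : ℕ
  r = suc (n + n)
  m = r * 2
  k = s * 2
  L = r * (2 * s)

  G : Graph
  G = C m ∨ W k

  4≤k : 4 ≤ k
  4≤k = ℕ.*-monoˡ-≤ 2 2≤s

  instance
    k-nonZero : NonZero k
    k-nonZero = ℕ.>-nonZero (ℕ.≤-trans (s≤s z≤n) 4≤k)

    s-nonZero : NonZero s
    s-nonZero = ℕ.>-nonZero (ℕ.≤-trans (s≤s z≤n) 2≤s)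

  3≤k : 3 ≤ k
  3≤k = ℕ.≤-trans (s≤s (s≤s (s≤s z≤n))) 4≤k

  3≤m : 3 ≤ m
  3≤m = ℕ.≤-trans (s≤s (s≤s (s≤s z≤n))) (ℕ.*-monoˡ-≤ 2 {2} {r} (s≤s (ℕ.≤-trans 1≤n (ℕ.m≤m+n n n))))

  Item : Set
  Item = ((Fin r × Fin 2) ⊎ (Fin k ⊎ Fin 1)) ⊎ ((Fin r × Fin 2) ⊎ (Fin k ⊎ Fin k) ⊎ ((Fin r × Fin 2) × ((Fin s × Fin 2) ⊎ Fin 1)))

  item : (Vertex G ⊎ JoinEdge m k) ↔ Item
  item = ↔-trans +↔⊎ (*↔× ⊎-↔ +↔⊎) ⊎-↔ (*↔× ⊎-↔ (↔-id _ ⊎-↔ (*↔× ×-↔ ↔-trans +↔⊎ (*↔× ⊎-↔ ↔-id _))))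

  Cell : Set
  Cell = Fin r × Fin 2 × Fin s

  -- Nested to the left like `_⊕_`, so that every block starts at the sum of the lengths of the
  -- blocks below it.
  Slot : Set
  Slot = ((((((((((Cell ⊎ Cell) ⊎ Fin 1) ⊎ Fin k) ⊎ Fin r) ⊎ Fin r) ⊎ Fin r) ⊎ Fin r) ⊎ Fin k) ⊎ Fin k) ⊎ Fin r) ⊎ Fin r

  -- The labels are assigned block by block from low to high.  Index i of the cycle and j of the
  -- rim are split as i = 2a + ε and j = 2l + δ; the subscripts ₑ and ₒ stand for ε = 0 and ε = 1.
  pattern hubₒ x = inj₂ x
  pattern hubₑ x = inj₁ (inj₂ x)
  pattern spokes x = inj₁ (inj₁ (inj₂ x))
  pattern rims x = inj₁ (inj₁ (inj₁ (inj₂ x)))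
  pattern cycₑ x = inj₁ (inj₁ (inj₁ (inj₁ (inj₂ x))))
  pattern cycₒ x = inj₁ (inj₁ (inj₁ (inj₁ (inj₁ (inj₂ x)))))
  pattern edgeₒ x = inj₁ (inj₁ (inj₁ (inj₁ (inj₁ (inj₁ (inj₂ x))))))
  pattern edgeₑ x = inj₁ (inj₁ (inj₁ (inj₁ (inj₁ (inj₁ (inj₁ (inj₂ x)))))))
  pattern rimEdges x = inj₁ (inj₁ (inj₁ (inj₁ (inj₁ (inj₁ (inj₁ (inj₁ (inj₂ x))))))))
  pattern centre x = inj₁ (inj₁ (inj₁ (inj₁ (inj₁ (inj₁ (inj₁ (inj₁ (inj₁ (inj₂ x)))))))))
  pattern high x = inj₁ (inj₁ (inj₁ (inj₁ (inj₁ (inj₁ (inj₁ (inj₁ (inj₁ (inj₁ (inj₂ x))))))))))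
  pattern low x = inj₁ (inj₁ (inj₁ (inj₁ (inj₁ (inj₁ (inj₁ (inj₁ (inj₁ (inj₁ (inj₁ x))))))))))

  -- The labels of the cross edges form 2 × 2 blocks (x, N − y; N − x, y), indexed by a and l.
  slot : Item → Slot
  slot (inj₁ (inj₁ (a , 0F))) = cycₑ a
  slot (inj₁ (inj₁ (a , 1F))) = cycₒ a
  slot (inj₁ (inj₂ (inj₁ j))) = rims j
  slot (inj₁ (inj₂ (inj₂ h))) = centre h
  slot (inj₂ (inj₁ (a , 0F))) = edgeₑ a
  slot (inj₂ (inj₁ (a , 1F))) = edgeₒ a
  slot (inj₂ (inj₂ (inj₁ (inj₁ j)))) = rimEdges j
  slot (inj₂ (inj₂ (inj₁ (inj₂ j)))) = spokes j
  slot (inj₂ (inj₂ (inj₂ ((a , 0F) , inj₁ (l , 0F))))) = low (a , 0F , l)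
  slot (inj₂ (inj₂ (inj₂ ((a , 0F) , inj₁ (l , 1F))))) = high (a , 1F , l)
  slot (inj₂ (inj₂ (inj₂ ((a , 1F) , inj₁ (l , 0F))))) = high (a , 0F , l)
  slot (inj₂ (inj₂ (inj₂ ((a , 1F) , inj₁ (l , 1F))))) = low (a , 1F , l)
  slot (inj₂ (inj₂ (inj₂ ((a , 0F) , inj₂ h)))) = hubₑ a
  slot (inj₂ (inj₂ (inj₂ ((a , 1F) , inj₂ h)))) = hubₒ a

  unslot : Slot → Item
  unslot (cycₑ a)     = inj₁ (inj₁ (a , 0F))
  unslot (cycₒ a)     = inj₁ (inj₁ (a , 1F))
  unslot (rims j)     = inj₁ (inj₂ (inj₁ j))
  unslot (centre h)   = inj₁ (inj₂ (inj₂ h))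
  unslot (edgeₑ a)    = inj₂ (inj₁ (a , 0F))
  unslot (edgeₒ a)    = inj₂ (inj₁ (a , 1F))
  unslot (rimEdges j) = inj₂ (inj₂ (inj₁ (inj₁ j)))
  unslot (spokes j)   = inj₂ (inj₂ (inj₁ (inj₂ j)))
  unslot (low (a , 0F , l))  = inj₂ (inj₂ (inj₂ ((a , 0F) , inj₁ (l , 0F))))
  unslot (low (a , 1F , l))  = inj₂ (inj₂ (inj₂ ((a , 1F) , inj₁ (l , 1F))))
  unslot (high (a , 0F , l)) = inj₂ (inj₂ (inj₂ ((a , 1F) , inj₁ (l , 0F))))
  unslot (high (a , 1F , l)) = inj₂ (inj₂ (inj₂ ((a , 0F) , inj₁ (l , 1F))))
  unslot (hubₑ a)     = inj₂ (inj₂ (inj₂ ((a , 0F) , inj₂ 0F)))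
  unslot (hubₒ a)     = inj₂ (inj₂ (inj₂ ((a , 1F) , inj₂ 0F)))

  unslot-slot : ∀ x → unslot (slot x) ≡ x
  unslot-slot (inj₁ (inj₁ (a , 0F))) = refl
  unslot-slot (inj₁ (inj₁ (a , 1F))) = refl
  unslot-slot (inj₁ (inj₂ (inj₁ j))) = refl
  unslot-slot (inj₁ (inj₂ (inj₂ h))) = refl
  unslot-slot (inj₂ (inj₁ (a , 0F))) = refl
  unslot-slot (inj₂ (inj₁ (a , 1F))) = refl
  unslot-slot (inj₂ (inj₂ (inj₁ (inj₁ j)))) = refl
  unslot-slot (inj₂ (inj₂ (inj₁ (inj₂ j)))) = refl
  unslot-slot (inj₂ (inj₂ (inj₂ ((a , 0F) , inj₁ (l , 0F))))) = refl
  unslot-slot (inj₂ (inj₂ (inj₂ ((a , 0F) , inj₁ (l , 1F))))) = refl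
  unslot-slot (inj₂ (inj₂ (inj₂ ((a , 1F) , inj₁ (l , 0F))))) = refl
  unslot-slot (inj₂ (inj₂ (inj₂ ((a , 1F) , inj₁ (l , 1F))))) = refl
  unslot-slot (inj₂ (inj₂ (inj₂ ((a , 0F) , inj₂ 0F)))) = refl
  unslot-slot (inj₂ (inj₂ (inj₂ ((a , 1F) , inj₂ 0F)))) = refl

  slot↣ : Item ↣ Slot
  slot↣ = mk↣ {to = slot} λ {x} {y} eq → trans (≡-sym (unslot-slot x)) (trans (cong unslot eq) (unslot-slot y))

  -- Every block has column sums N.  Reversing the large labels within the first pair of rows
  -- keeps the row sums but adds 2l to the columns of block l, up to a constant, which compensates
  -- for the decrease of the rim and spoke labels along the rim.
  mirror : Fin r → Fin s → Fin s
  mirror zero    = opposite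
  mirror (suc _) = id

  mirror-injective : ∀ a → Injective _≡_ _≡_ (mirror a)
  mirror-injective zero    = opposite-injective
  mirror-injective (suc _) = id

  -- Lexicographic with `δ` above `l`, that is 2sa + sδ + l; this produces the difference y - x = s
  -- within a block.
  cell : Cell → Fin L
  cell (a , δ , l) = combine a (combine δ l)

  cell-injective : Injective _≡_ _≡_ cell
  cell-injective {a , δ , l} {a′ , δ′ , l′} eq with Fin.combine-injective a (combine δ l) a′ (combine δ′ l′) eq
  ... | refl , eq′ with Fin.combine-injective δ l δ′ l′ eq′
  ... | refl , refl = refl

  mirrorCell : Cell → Cell
  mirrorCell (a , δ , l) = a , δ , mirror a l

  mirrorCell-injective : Injective _≡_ _≡_ mirrorCell
  mirrorCell-injective {a , δ , l} {a′ , δ′ , l′} eq with cong proj₁ eq | cong (proj₁ ∘ proj₂) eq | cong (proj₂ ∘ proj₂) eq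
  ... | refl | refl | eq″ = cong (λ x → a , δ , x) (mirror-injective a eq″)

  -- Offsets at which `centre`, `rimEdges`, `edgeₑ`, `edgeₒ`, `cycₒ`, `cycₑ`, `rims`, `spokes`,
  -- `hubₑ`, `hubₒ` begin, and the total. Odd cycle vertices collect `XE` twice and `HO`, even ones
  -- `XO` twice and `HE`; together with the row sums this puts the two cycle colours 3r + 2s² apart.
  Z EP EE EO XO XE Y TT HE HO T : ℕ
  Z  = L + L
  EP = Z + 1
  EE = EP + k
  EO = EE + r
  XO = EO + r
  XE = XO + r
  Y  = XE + r
  TT = Y + k
  HE = TT + k
  HO = HE + r
  T  = HO + r

  -- The order within each block is chosen for exact cancellation. At the even vertex 2a, with b =
  -- `prev a`, the edge behind carries `opposite b` and the hub edge b, while the a of the edge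
  -- ahead cancels against the reversed zigzag labels of b and a. At the odd vertex 2a + 1 the two
  -- cycle edges carry a and `opposite a`, while the zigzag sum n + `next a` meets
  -- `opposite (next a)` on the hub edge. At rim vertex j, `opposite ∘ next` on the spoke matches
  -- the label of the successor even where the rim closes.
  slotPacking : Packing Slot T
  slotPacking =
      (finPacking L ∘ₚ mk↣ cell-injective)
    ⊕ (finPacking L ∘ₚ mk↣ {to = opposite ∘ cell ∘ mirrorCell} (mirrorCell-injective ∘ cell-injective ∘ opposite-injective))
    ⊕ finPacking 1
    ⊕ (finPacking k ∘ₚ mk↣ {to = opposite} opposite-injective)
    ⊕ finPacking r
    ⊕ (finPacking r ∘ₚ mk↣ {to = opposite} opposite-injective)
    ⊕ (finPacking r ∘ₚ mk↣ {to = opposite ∘ zigzag n} (zigzag-injective n ∘ opposite-injective))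
    ⊕ (finPacking r ∘ₚ mk↣ {to = zigzag n} (zigzag-injective n))
    ⊕ finPacking k
    ⊕ (finPacking k ∘ₚ mk↣ {to = opposite ∘ next} (next-injective ∘ opposite-injective))
    ⊕ (finPacking r ∘ₚ mk↣ {to = prev} prev-injective)
    ⊕ (finPacking r ∘ₚ mk↣ {to = opposite ∘ next} (next-injective ∘ opposite-injective))

  packing : Packing (Vertex G ⊎ JoinEdge m k) T
  packing = (slotPacking ∘ₚ slot↣) ∘ₚ ↔⇒↣ item

  T≡ : T ≡ Graph.order G + joinSize m k
  T≡ = lem (suc (n + n)) s
    where
    lem : ∀ r s → r * (2 * s) + r * (2 * s) + 1 + s * 2 + r + r + r + r + s * 2 + s * 2 + r + r ≡
          r * 2 + (s * 2 + 1) + (r * 2 + ((s * 2 + s * 2) + r * 2 * (s * 2 + 1)))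
    lem = solve-∀

  open InducedColours 3≤m 3≤k T≡ packing public

  private
    at-item : ∀ (x : Vertex G ⊎ JoinEdge m k) {y : Item} → Inverse.to item x ≡ y → ℕ.suc (at packing x) ≡ ℕ.suc (at slotPacking (slot y))
    at-item x eq = cong (λ y → ℕ.suc (at slotPacking (slot y))) eq

    item-cyc : ∀ a ε → Inverse.to item (inj₁ (cyc (combine a ε))) ≡ inj₁ (inj₁ (a , ε))
    item-cyc a ε rewrite splitAt-↑ˡ m (combine a ε) (k + 1) | remQuot-combine a ε = refl

    item-rim : ∀ j → Inverse.to item (inj₁ (rim j)) ≡ inj₁ (inj₂ (inj₁ j))
    item-rim j rewrite splitAt-↑ʳ m (k + 1) (j ↑ˡ 1) | splitAt-↑ˡ k j 1 = refl

    item-hub : Inverse.to item (inj₁ hub) ≡ inj₁ (inj₂ (inj₂ 0F))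
    item-hub rewrite splitAt-↑ʳ m (k + 1) (k ↑ʳ 0F) | splitAt-↑ʳ k 1 0F = refl

    item-cycEdge : ∀ a ε → Inverse.to item (inj₂ (inj₁ (combine a ε))) ≡ inj₂ (inj₁ (a , ε))
    item-cycEdge a ε rewrite remQuot-combine a ε = refl

    item-cross : ∀ a ε l δ → Inverse.to item (inj₂ (inj₂ (inj₂ (combine a ε , combine l δ ↑ˡ 1)))) ≡ inj₂ (inj₂ (inj₂ ((a , ε) , inj₁ (l , δ))))
    item-cross a ε l δ rewrite remQuot-combine a ε | splitAt-↑ˡ k (combine l δ) 1 | remQuot-combine l δ = refl

    item-cycHub : ∀ a ε → Inverse.to item (inj₂ (inj₂ (inj₂ (combine a ε , k ↑ʳ 0F)))) ≡ inj₂ (inj₂ (inj₂ ((a , ε) , inj₂ 0F)))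
    item-cycHub a ε rewrite remQuot-combine a ε | splitAt-↑ʳ k 1 0F = refl

  vertexLabel-cyc₀ : ∀ a → vertexLabel (cyc (combine a 0F)) ≡ suc (XE + toℕ (zigzag n a))
  vertexLabel-cyc₀ a = at-item (inj₁ (cyc (combine a 0F))) (item-cyc a 0F)

  vertexLabel-cyc₁ : ∀ a → vertexLabel (cyc (combine a 1F)) ≡ suc (XO + toℕ (opposite (zigzag n a)))
  vertexLabel-cyc₁ a = at-item (inj₁ (cyc (combine a 1F))) (item-cyc a 1F)

  vertexLabel-rim : ∀ j → vertexLabel (rim j) ≡ suc (Y + toℕ j)
  vertexLabel-rim j = at-item (inj₁ (rim j)) (item-rim j)

  vertexLabel-hub : vertexLabel hub ≡ suc (Z + 0)
  vertexLabel-hub = at-item (inj₁ hub) item-hub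

  cycEdgeLabel₀ : ∀ a → cycEdgeLabel (combine a 0F) ≡ suc (EE + toℕ a)
  cycEdgeLabel₀ a = at-item (inj₂ (inj₁ (combine a 0F))) (item-cycEdge a 0F)

  cycEdgeLabel₁ : ∀ a → cycEdgeLabel (combine a 1F) ≡ suc (EO + toℕ (opposite a))
  cycEdgeLabel₁ a = at-item (inj₂ (inj₁ (combine a 1F))) (item-cycEdge a 1F)

  cycHubLabel₀ : ∀ a → cycHubLabel (combine a 0F) ≡ suc (HE + toℕ (prev a))
  cycHubLabel₀ a = at-item (inj₂ (inj₂ (inj₂ (combine a 0F , k ↑ʳ 0F)))) (item-cycHub a 0F)

  cycHubLabel₁ : ∀ a → cycHubLabel (combine a 1F) ≡ suc (HO + toℕ (opposite (next a)))
  cycHubLabel₁ a = at-item (inj₂ (inj₂ (inj₂ (combine a 1F , k ↑ʳ 0F)))) (item-cycHub a 1F)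

  lo hi : Fin r → Fin 2 → Fin s → ℕ
  lo a δ l = suc (toℕ (cell (a , δ , l)))
  hi a δ l = suc (L + toℕ (opposite (cell (a , δ , mirror a l))))

  crossLabel₀₀ : ∀ a l → crossLabel (combine a 0F) (combine l 0F) ≡ lo a 0F l
  crossLabel₀₀ a l = at-item (inj₂ (inj₂ (inj₂ (combine a 0F , combine l 0F ↑ˡ 1)))) (item-cross a 0F l 0F)

  crossLabel₀₁ : ∀ a l → crossLabel (combine a 0F) (combine l 1F) ≡ hi a 1F l
  crossLabel₀₁ a l = at-item (inj₂ (inj₂ (inj₂ (combine a 0F , combine l 1F ↑ˡ 1)))) (item-cross a 0F l 1F)

  crossLabel₁₀ : ∀ a l → crossLabel (combine a 1F) (combine l 0F) ≡ hi a 0F l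
  crossLabel₁₀ a l = at-item (inj₂ (inj₂ (inj₂ (combine a 1F , combine l 0F ↑ˡ 1)))) (item-cross a 1F l 0F)

  crossLabel₁₁ : ∀ a l → crossLabel (combine a 1F) (combine l 1F) ≡ lo a 1F l
  crossLabel₁₁ a l = at-item (inj₂ (inj₂ (inj₂ (combine a 1F , combine l 1F ↑ˡ 1)))) (item-cross a 1F l 1F)

-- Row, column and block sums.

triangular-even : ∀ s → triangular (s * 2) + s ≡ 2 * s * s
triangular-even s = ℕ.*-cancelˡ-≡ _ _ 2 (begin
  2 * (triangular (s * 2) + s)                        ≡⟨ lem₁ (triangular (s * 2)) s ⟩
  triangular (s * 2) + triangular (s * 2) + s * 2     ≡⟨ triangular-double (s * 2) ⟩
  s * 2 * (s * 2)                                     ≡⟨ lem₂ s ⟩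
  2 * (2 * s * s)                                     ∎)
  where
  lem₁ : ∀ t s → 2 * (t + s) ≡ t + t + s * 2
  lem₁ = solve-∀
  lem₂ : ∀ s → s * 2 * (s * 2) ≡ 2 * (2 * s * s)
  lem₂ = solve-∀

sum-even : ∀ {s} c {g : Fin (s * 2) → Fin (s * 2)} → Injective _≡_ _≡_ g →
           sum (λ i → suc (c + toℕ (g i))) + s ≡ s * 2 * suc c + 2 * s * s
sum-even {s} c inj = trans (cong (_+ s) (sum-shift c inj)) (trans (ℕ.+-assoc (s * 2 * suc c) _ s) (cong (s * 2 * suc c +_) (triangular-even s)))

sum-two : ∀ {r} c d {g h : Fin r → Fin r} → Injective _≡_ _≡_ g → Injective _≡_ _≡_ h →
          sum (λ i → suc (c + toℕ (g i)) + suc (d + toℕ (h i))) + r ≡ r * suc c + r * suc d + r * r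
sum-two {r} c d {g} {h} g-inj h-inj = begin
  sum (λ i → suc (c + toℕ (g i)) + suc (d + toℕ (h i))) + r   ≡⟨ cong (_+ r) (∑-distrib-+ (λ i → suc (c + toℕ (g i))) (λ i → suc (d + toℕ (h i)))) ⟩
  sum (λ i → suc (c + toℕ (g i))) + sum (λ i → suc (d + toℕ (h i))) + r ≡⟨ cong (_+ r) (cong₂ _+_ (sum-shift c g-inj) (sum-shift d h-inj)) ⟩
  (r * suc c + t) + (r * suc d + t) + r                       ≡⟨ lem (r * suc c) (r * suc d) t r ⟩
  r * suc c + r * suc d + (t + t + r)                         ≡⟨ cong (r * suc c + r * suc d +_) (triangular-double r) ⟩
  r * suc c + r * suc d + r * r                               ∎
  where
  t = triangular r
  lem : ∀ x y t r → (x + t) + (y + t) + r ≡ x + y + (t + t + r)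
  lem = solve-∀

module Sums (n s : ℕ) (1≤n : 1 ≤ n) (2≤s : 2 ≤ s) where

  open Design n s 1≤n 2≤s

  N : ℕ
  N = suc (L + L)

  lo-value : ∀ a δ l → lo a δ l ≡ suc (2 * s * toℕ a + (s * toℕ δ + toℕ l))
  lo-value a δ l = cong suc (trans (toℕ-combine a (combine δ l)) (cong (2 * s * toℕ a +_) (toℕ-combine δ l)))

  lo-step : ∀ a l → lo a 0F l + s ≡ lo a 1F l
  lo-step a l = begin
    lo a 0F l + s                                   ≡⟨ cong (_+ s) (lo-value a 0F l) ⟩
    suc (2 * s * toℕ a + (s * 0 + toℕ l)) + s       ≡⟨ lem (2 * s * toℕ a) s (toℕ l) ⟩
    suc (2 * s * toℕ a + (s * 1 + toℕ l))           ≡⟨ lo-value a 1F l ⟨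
    lo a 1F l                                       ∎
    where
    lem : ∀ x s l → suc (x + (s * 0 + l)) + s ≡ suc (x + (s * 1 + l))
    lem = solve-∀

  lo-swap : ∀ a δ l l′ → lo a δ l + toℕ l′ ≡ lo a δ l′ + toℕ l
  lo-swap a δ l l′ = begin
    lo a δ l + toℕ l′                                     ≡⟨ cong (_+ toℕ l′) (lo-value a δ l) ⟩
    suc (2 * s * toℕ a + (s * toℕ δ + toℕ l)) + toℕ l′    ≡⟨ lem (2 * s * toℕ a) (s * toℕ δ) (toℕ l) (toℕ l′) ⟩
    suc (2 * s * toℕ a + (s * toℕ δ + toℕ l′)) + toℕ l    ≡⟨ cong (_+ toℕ l) (lo-value a δ l′) ⟨
    lo a δ l′ + toℕ l                                     ∎
    where
    lem : ∀ x y l l′ → suc (x + (y + l)) + l′ ≡ suc (x + (y + l′)) + l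
    lem = solve-∀

  lo+hi : ∀ a δ l → lo a δ (mirror a l) + hi a δ l ≡ N
  lo+hi a δ l = trans (lem (toℕ c) L (toℕ (opposite c))) (cong (λ x → suc (L + x)) (toℕ-opposite c))
    where
    c = cell (a , δ , mirror a l)
    lem : ∀ c L o → suc c + suc (L + o) ≡ suc (L + (c + suc o))
    lem = solve-∀

  -- Each `hi` complements a `lo` at the mirrored place, and permuting `l` does not change the
  -- total.
  sum-lo+hi : ∀ a δ → sum (lo a δ) + sum (hi a δ) ≡ s * N
  sum-lo+hi a δ = begin
    sum (lo a δ) + sum (hi a δ)                     ≡⟨ cong (_+ sum (hi a δ)) (sum-∘ (lo a δ) (mirror-injective a)) ⟨
    sum (lo a δ ∘ mirror a) + sum (hi a δ)          ≡⟨ ∑-distrib-+ (lo a δ ∘ mirror a) (hi a δ) ⟨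
    sum (λ l → lo a δ (mirror a l) + hi a δ l)      ≡⟨ sum-cong-≗ (lo+hi a δ) ⟩
    sum {s} (λ _ → N)                               ≡⟨ sum-const s N ⟩
    s * N                                           ∎

  sum-lo-step : ∀ a → sum (lo a 0F) + s * s ≡ sum (lo a 1F)
  sum-lo-step a = begin
    sum (lo a 0F) + s * s                ≡⟨ cong (sum (lo a 0F) +_) (sum-const s s) ⟨
    sum (lo a 0F) + sum {s} (λ _ → s)    ≡⟨ ∑-distrib-+ (lo a 0F) (λ _ → s) ⟨
    sum (λ l → lo a 0F l + s)            ≡⟨ sum-cong-≗ (lo-step a) ⟩
    sum (lo a 1F)                        ∎

  -- Up to the order of its entries the row consists of labels x and complements N - y with y = x +
  -- s, so each of the s blocks contributes N - s.
  rowSum₀ : ∀ a → sum (crossLabel (combine a 0F)) + s * s ≡ s * N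
  rowSum₀ a = begin
    sum (crossLabel (combine a 0F)) + s * s
      ≡⟨ cong (_+ s * s) (sum-combine₂ s (crossLabel (combine a 0F))) ⟩
    sum (λ (l : Fin s) → crossLabel (combine a 0F) (combine l 0F) + crossLabel (combine a 0F) (combine l 1F)) + s * s
      ≡⟨ cong (_+ s * s) (sum-cong-≗ λ (l : Fin s) → cong₂ _+_ (crossLabel₀₀ a l) (crossLabel₀₁ a l)) ⟩
    sum (λ l → lo a 0F l + hi a 1F l) + s * s
      ≡⟨ cong (_+ s * s) (∑-distrib-+ (lo a 0F) (hi a 1F)) ⟩
    sum (lo a 0F) + sum (hi a 1F) + s * s
      ≡⟨ lem (sum (lo a 0F)) (sum (hi a 1F)) (s * s) ⟩
    sum (lo a 0F) + s * s + sum (hi a 1F)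
      ≡⟨ cong (_+ sum (hi a 1F)) (sum-lo-step a) ⟩
    sum (lo a 1F) + sum (hi a 1F)
      ≡⟨ sum-lo+hi a 1F ⟩
    s * N ∎
    where
    lem : ∀ x y z → x + y + z ≡ x + z + y
    lem = solve-∀

  rowSum₁ : ∀ a → sum (crossLabel (combine a 1F)) ≡ s * N + s * s
  rowSum₁ a = begin
    sum (crossLabel (combine a 1F))
      ≡⟨ sum-combine₂ s (crossLabel (combine a 1F)) ⟩
    sum (λ (l : Fin s) → crossLabel (combine a 1F) (combine l 0F) + crossLabel (combine a 1F) (combine l 1F))
      ≡⟨ sum-cong-≗ (λ (l : Fin s) → cong₂ _+_ (crossLabel₁₀ a l) (crossLabel₁₁ a l)) ⟩
    sum (λ l → hi a 0F l + lo a 1F l)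
      ≡⟨ ∑-distrib-+ (hi a 0F) (lo a 1F) ⟩
    sum (hi a 0F) + sum (lo a 1F)
      ≡⟨ cong (sum (hi a 0F) +_) (sum-lo-step a) ⟨
    sum (hi a 0F) + (sum (lo a 0F) + s * s)
      ≡⟨ lem (sum (hi a 0F)) (sum (lo a 0F)) (s * s) ⟩
    sum (lo a 0F) + sum (hi a 0F) + s * s
      ≡⟨ cong (_+ s * s) (sum-lo+hi a 0F) ⟩
    s * N + s * s ∎
    where
    lem : ∀ x y z → x + (y + z) ≡ y + x + z
    lem = solve-∀

  column : ∀ l δ → sum (λ i → crossLabel i (combine l δ)) ≡ sum (λ a → lo a δ l + hi a δ l)
  column l 0F = trans (sum-combine₂ r λ i → crossLabel i (combine l 0F))
    (sum-cong-≗ λ (a : Fin r) → cong₂ _+_ (crossLabel₀₀ a l) (crossLabel₁₀ a l))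
  column l 1F = trans (sum-combine₂ r λ i → crossLabel i (combine l 1F))
    (sum-cong-≗ λ (a : Fin r) → trans (cong₂ _+_ (crossLabel₀₁ a l) (crossLabel₁₁ a l)) (ℕ.+-comm (hi a 1F l) (lo a 1F l)))

  -- Every pair of rows but the first gives N. In the first the complement belongs to `opposite l`,
  -- and labels grow by 1 with `l`, so the sum shifts by l - `opposite l`.
  columnSum : ∀ l δ → sum (λ i → crossLabel i (combine l δ)) + toℕ (opposite l) ≡ r * N + toℕ l
  columnSum l δ = begin
    sum (λ i → crossLabel i (combine l δ)) + o
      ≡⟨ cong (_+ o) (column l δ) ⟩
    lo 0F δ l + hi 0F δ l + sum (λ a → lo (suc a) δ l + hi (suc a) δ l) + o
      ≡⟨ cong (λ x → lo 0F δ l + hi 0F δ l + x + o) (trans (sum-cong-≗ λ a → lo+hi (suc a) δ l) (sum-const (n + n) N)) ⟩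
    lo 0F δ l + hi 0F δ l + (n + n) * N + o
      ≡⟨ lem₁ (lo 0F δ l) (hi 0F δ l) ((n + n) * N) o ⟩
    lo 0F δ l + o + hi 0F δ l + (n + n) * N
      ≡⟨ cong (λ x → x + hi 0F δ l + (n + n) * N) (lo-swap 0F δ l (opposite l)) ⟩
    lo 0F δ (opposite l) + toℕ l + hi 0F δ l + (n + n) * N
      ≡⟨ lem₂ (lo 0F δ (opposite l)) (toℕ l) (hi 0F δ l) ((n + n) * N) ⟩
    lo 0F δ (opposite l) + hi 0F δ l + (n + n) * N + toℕ l
      ≡⟨ cong (λ x → x + (n + n) * N + toℕ l) (lo+hi 0F δ l) ⟩
    r * N + toℕ l ∎
    where
    o = toℕ (opposite l)
    lem₁ : ∀ x y z o → x + y + z + o ≡ x + o + y + z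
    lem₁ = solve-∀
    lem₂ : ∀ x y z w → x + y + z + w ≡ x + z + w + y
    lem₂ = solve-∀

  cycSum : sum (vertexLabel ∘ cyc) + r ≡ r * suc XE + r * suc XO + r * r
  cycSum = trans (cong (_+ r) (trans (sum-combine₂ r (vertexLabel ∘ cyc)) (sum-cong-≗ λ (a : Fin r) → cong₂ _+_ (vertexLabel-cyc₀ a) (vertexLabel-cyc₁ a))))
    (sum-two XE XO (zigzag-injective n) (zigzag-injective n ∘ opposite-injective))

  cycHubSum : sum cycHubLabel + r ≡ r * suc HE + r * suc HO + r * r
  cycHubSum = trans (cong (_+ r) (trans (sum-combine₂ r cycHubLabel) (sum-cong-≗ λ (a : Fin r) → cong₂ _+_ (cycHubLabel₀ a) (cycHubLabel₁ a))))
    (sum-two HE HO prev-injective (next-injective ∘ opposite-injective))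

  rimSum : sum (vertexLabel ∘ rim) + s ≡ k * suc Y + 2 * s * s
  rimSum = trans (cong (_+ s) (sum-cong-≗ vertexLabel-rim)) (sum-even {s} Y id)

  spokeSum : sum spokeLabel + s ≡ k * suc TT + 2 * s * s
  spokeSum = sum-even {s} TT (next-injective ∘ opposite-injective)

-- Closed forms of the colours, shifted so that no subtraction occurs: the cycle vertices have
-- colours evenCyc − s² and oddCyc, the rim vertices rimTotal and rimTotal − 1.
evenCyc oddCyc : ℕ → ℕ → ℕ → ℕ
evenCyc n r s  = 5 * n + 12 * r * s * s + 32 * r * s + 9 * r + 6 * s * s + 18 * s + 11
oddCyc n r s   = 12 * r * s * s + 32 * r * s + 14 * r + 7 * s * s + 18 * s + 9 + n

rimTotal hubTotal : ℕ → ℕ → ℕ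
rimTotal r s   = 12 * r * r * s + 6 * r * r + 28 * r * s + 16 * r + 13 * s + 9
hubTotal r s   = 16 * r * r * s + 16 * r * r + 16 * r * s * s + 32 * r * s + 6 * r + 16 * s * s + 6 * s

-- Evaluation of the colours.

module Totals (n s : ℕ) (1≤n : 1 ≤ n) (2≤s : 2 ≤ s) where

  open Design n s 1≤n 2≤s public
  open Sums n s 1≤n 2≤s

  f : Vertex G → ℕ
  f = f⁺ {G} labeling

  f-even : ∀ (a : Fin r) → f (cyc (combine a 0F)) + s * s ≡ evenCyc n r s
  f-even a = ℕ.+-cancelʳ-≡ s _ _ (begin
    f (cyc (combine a 0F)) + s * s + s
      ≡⟨ cong (λ x → x + s * s + s) (f⁺-cyc (combine b 1F) (trans (next-combine₁ b) (cong (λ x → combine x 0F) nb≡a)) (next-combine₀ a)) ⟩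
    ((cycEdgeLabel (combine b 1F) + vertexLabel (cyc (combine b 1F))) + (cycEdgeLabel (combine a 0F) + vertexLabel (cyc (combine a 1F))))
      + (S + Σy + (cycHubLabel (combine a 0F) + vertexLabel hub)) + s * s + s
      ≡⟨ cong (λ x → x + s * s + s) (cong₂ _+_
           (cong₂ _+_ (cong₂ _+_ (cycEdgeLabel₁ b) (vertexLabel-cyc₁ b)) (cong₂ _+_ (cycEdgeLabel₀ a) (vertexLabel-cyc₁ a)))
           (cong (S + Σy +_) (cong₂ _+_ (cycHubLabel₀ a) vertexLabel-hub))) ⟩
    ((suc (EO + ob) + suc (XO + owb)) + (suc (EE + toℕ a) + suc (XO + owa))) + (S + Σy + (suc (HE + toℕ b) + suc (Z + 0))) + s * s + s
      ≡⟨ rearrange EO XO EE HE Z ob owb (toℕ a) owa S Σy (toℕ b) (s * s) s ⟩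
    (EO + XO + EE + XO + HE + Z + 6) + (toℕ b + ob) + (toℕ a + owb + owa) + (S + s * s) + (Σy + s)
      ≡⟨ cong₂ _+_ (cong₂ _+_ (cong₂ _+_ (cong (EO + XO + EE + XO + HE + Z + 6 +_) b+ob) a+owb+owa) (rowSum₀ a)) rimSum ⟩
    (EO + XO + EE + XO + HE + Z + 6) + (n + n) + (n + n + n) + s * N + (k * suc Y + 2 * s * s)
      ≡⟨ evaluate n r s ⟩
    evenCyc n r s + s ∎)
    where
    b : Fin r
    b = prev a
    nb≡a : next b ≡ a
    nb≡a = next-prev a
    S = sum (crossLabel (combine a 0F))
    Σy = sum (vertexLabel ∘ rim)
    ob = toℕ (opposite b)
    owa = toℕ (opposite (zigzag n a))
    owb = toℕ (opposite (zigzag n b))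
    wa = toℕ (zigzag n a)
    wb = toℕ (zigzag n b)
    below : ∀ (x : Fin r) → toℕ x + toℕ (opposite x) ≡ n + n
    below x = ℕ.suc-injective (trans (≡-sym (ℕ.+-suc (toℕ x) _)) (toℕ-opposite x))
    b+ob : toℕ b + ob ≡ n + n
    b+ob = below b
    a+owb+owa : toℕ a + owb + owa ≡ n + n + n
    -- With n added, n + a is the zigzag sum at b and a, and each zigzag label meets its own
    -- reversal.
    a+owb+owa = ℕ.+-cancelˡ-≡ n _ _ (begin
      n + (toℕ a + owb + owa)        ≡⟨ lem₁ n (toℕ a) owb owa ⟩
      n + toℕ a + owb + owa          ≡⟨ cong (λ x → x + owb + owa) (trans (cong (λ x → n + toℕ x) (≡-sym nb≡a)) (≡-sym (trans (cong (λ x → wb + toℕ (zigzag n x)) (≡-sym nb≡a)) (zigzag-next n b)))) ⟩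
      wb + wa + owb + owa            ≡⟨ lem₂ wb wa owb owa ⟩
      (wb + owb) + (wa + owa)        ≡⟨ cong₂ _+_ (below (zigzag n b)) (below (zigzag n a)) ⟩
      n + n + (n + n)                ≡⟨ lem₃ n ⟩
      n + (n + n + n)                ∎)
      where
      lem₁ : ∀ n a x y → n + (a + x + y) ≡ n + a + x + y
      lem₁ = solve-∀
      lem₂ : ∀ a b x y → a + b + x + y ≡ (a + x) + (b + y)
      lem₂ = solve-∀
      lem₃ : ∀ n → n + n + (n + n) ≡ n + (n + n + n)
      lem₃ = solve-∀
    rearrange : ∀ EO XO EE HE Z ob owb a owa S Σy b s² s →
      ((suc (EO + ob) + suc (XO + owb)) + (suc (EE + a) + suc (XO + owa))) + (S + Σy + (suc (HE + b) + suc (Z + 0))) + s² + s ≡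
      (EO + XO + EE + XO + HE + Z + 6) + (b + ob) + (a + owb + owa) + (S + s²) + (Σy + s)
    rearrange = solve-∀
    -- The `let` writes the offsets out as polynomials for the ring solver, with `n` and `r` as
    -- separate variables.
    evaluate : ∀ n r s →
      let k = s * 2 ; L = r * (2 * s) ; Z = L + L ; EE = Z + 1 + k ; EO = EE + r ; XO = EO + r ; Y = XO + r + r ; HE = Y + k + k in
      (EO + XO + EE + XO + HE + Z + 6) + (n + n) + (n + n + n) + s * suc (L + L) + (k * suc Y + 2 * s * s) ≡
      (5 * n + 12 * r * s * s + 32 * r * s + 9 * r + 6 * s * s + 18 * s + 11) + s
    evaluate = solve-∀

  f-odd : ∀ (a : Fin r) → f (cyc (combine a 1F)) ≡ oddCyc n r s
  f-odd a = ℕ.+-cancelʳ-≡ s _ _ (begin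
    f (cyc (combine a 1F)) + s
      ≡⟨ cong (_+ s) (f⁺-cyc (combine a 0F) (next-combine₀ a) (next-combine₁ a)) ⟩
    ((cycEdgeLabel (combine a 0F) + vertexLabel (cyc (combine a 0F))) + (cycEdgeLabel (combine a 1F) + vertexLabel (cyc (combine a′ 0F))))
      + (S + Σy + (cycHubLabel (combine a 1F) + vertexLabel hub)) + s
      ≡⟨ cong (_+ s) (cong₂ _+_
           (cong₂ _+_ (cong₂ _+_ (cycEdgeLabel₀ a) (vertexLabel-cyc₀ a)) (cong₂ _+_ (cycEdgeLabel₁ a) (vertexLabel-cyc₀ a′)))
           (cong (S + Σy +_) (cong₂ _+_ (cycHubLabel₁ a) vertexLabel-hub))) ⟩
    ((suc (EE + toℕ a) + suc (XE + wa)) + (suc (EO + oa) + suc (XE + wa′))) + (S + Σy + (suc (HO + oa′) + suc (Z + 0))) + s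
      ≡⟨ rearrange EE EO XE HO Z (toℕ a) oa wa wa′ oa′ S Σy s ⟩
    (EE + EO + XE + XE + HO + Z + 5) + (toℕ a + suc oa) + (wa + wa′ + oa′) + S + (Σy + s)
      ≡⟨ cong₂ _+_ (cong₂ _+_ (cong₂ _+_ (cong (EE + EO + XE + XE + HO + Z + 5 +_) (toℕ-opposite a)) (cong (_+ oa′) (zigzag-next n a))) (rowSum₁ a)) rimSum ⟩
    (EE + EO + XE + XE + HO + Z + 5) + r + (n + toℕ a′ + oa′) + (s * N + s * s) + (k * suc Y + 2 * s * s)
      -- One unit of the constant moves to `oa′`, since `toℕ-opposite` adds up with `suc`.
      ≡⟨ rearrange′ (EE + EO + XE + XE + HO + Z) r n (toℕ a′) oa′ (s * N + s * s) (k * suc Y + 2 * s * s) ⟩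
    (EE + EO + XE + XE + HO + Z + 4) + r + (n + (toℕ a′ + suc oa′)) + (s * N + s * s) + (k * suc Y + 2 * s * s)
      ≡⟨ cong (λ x → (EE + EO + XE + XE + HO + Z + 4) + r + (n + x) + (s * N + s * s) + (k * suc Y + 2 * s * s)) (toℕ-opposite a′) ⟩
    (EE + EO + XE + XE + HO + Z + 4) + r + (n + r) + (s * N + s * s) + (k * suc Y + 2 * s * s)
      ≡⟨ evaluate n r s ⟩
    oddCyc n r s + s ∎)
    where
    a′ = next a
    S = sum (crossLabel (combine a 1F))
    Σy = sum (vertexLabel ∘ rim)
    oa = toℕ (opposite a)
    oa′ = toℕ (opposite a′)
    wa = toℕ (zigzag n a)
    wa′ = toℕ (zigzag n a′)
    rearrange : ∀ EE EO XE HO Z a oa wa wa′ oa′ S Σy s →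
      ((suc (EE + a) + suc (XE + wa)) + (suc (EO + oa) + suc (XE + wa′))) + (S + Σy + (suc (HO + oa′) + suc (Z + 0))) + s ≡
      (EE + EO + XE + XE + HO + Z + 5) + (a + suc oa) + (wa + wa′ + oa′) + S + (Σy + s)
    rearrange = solve-∀
    rearrange′ : ∀ c r n a o x y → c + 5 + r + (n + a + o) + x + y ≡ c + 4 + r + (n + (a + suc o)) + x + y
    rearrange′ = solve-∀
    evaluate : ∀ n r s →
      let k = s * 2 ; L = r * (2 * s) ; Z = L + L ; EE = Z + 1 + k ; EO = EE + r ; XE = EO + r + r ; Y = XE + r ; HO = Y + k + k + r in
      (EE + EO + XE + XE + HO + Z + 4) + r + (n + r) + (s * suc (L + L) + s * s) + (k * suc Y + 2 * s * s) ≡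
      (12 * r * s * s + 32 * r * s + 14 * r + 7 * s * s + 18 * s + 9 + n) + s
    evaluate = solve-∀

  f-rim : ∀ (l : Fin s) (δ : Fin 2) → f (rim (combine l δ)) + toℕ δ ≡ rimTotal r s
  f-rim l δ = ℕ.+-cancelʳ-≡ r _ _ (begin
    f (rim j₁) + toℕ δ + r
      ≡⟨ cong (λ x → x + toℕ δ + r) (f⁺-rim j₀ (next-prev j₁) refl) ⟩
    S + Σx + (((rimEdgeLabel j₀ + vertexLabel (rim j₀)) + (rimEdgeLabel j₁ + vertexLabel (rim j₂))) + (spokeLabel j₁ + vertexLabel hub)) + toℕ δ + r
      ≡⟨ cong (λ x → S + Σx + x + toℕ δ + r) (cong₂ _+_
           (cong₂ _+_ (cong (rimEdgeLabel j₀ +_) (vertexLabel-rim j₀)) (cong (rimEdgeLabel j₁ +_) (vertexLabel-rim j₂)))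
           (cong (spokeLabel j₁ +_) vertexLabel-hub)) ⟩
    S + Σx + (((suc (EP + o₀) + suc (Y + toℕ j₀)) + (suc (EP + o₁) + suc (Y + toℕ j₂))) + (suc (TT + o₂) + suc (Z + 0))) + toℕ δ + r
      ≡⟨ rearrange S Σx EP Y TT Z o₀ (toℕ j₀) o₁ (toℕ j₂) o₂ (toℕ δ) r ⟩
    (EP + Y + EP + Y + TT + Z + 4) + (toℕ j₀ + suc o₀) + (toℕ j₂ + suc o₂) + (o₁ + toℕ δ + S) + (Σx + r)
      ≡⟨ cong₂ _+_ (cong₂ _+_ (cong₂ _+_ (cong (EP + Y + EP + Y + TT + Z + 4 +_) (toℕ-opposite j₀)) (toℕ-opposite j₂)) o₁+δ+S) cycSum ⟩
    (EP + Y + EP + Y + TT + Z + 4) + k + k + (r * N + s) + (r * suc XE + r * suc XO + r * r)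
      ≡⟨ evaluate r s ⟩
    rimTotal r s + r ∎)
    where
    j₀ j₁ j₂ : Fin k
    j₁ = combine l δ
    j₀ = prev j₁
    j₂ = next j₁
    S = sum (λ i → crossLabel i j₁)
    Σx = sum (vertexLabel ∘ cyc)
    o₀ = toℕ (opposite j₀)
    o₁ = toℕ (opposite j₁)
    o₂ = toℕ (opposite j₂)
    ol = toℕ (opposite l)
    -- The left `opposite` is taken in `Fin k`, the right one in `Fin s`: k - 1 - (2l + δ) = 2(s - 1
    -- - l) + 1 - δ. One copy of `ol` cancels in `columnSum`, the other against `l`.
    o₁+δ : o₁ + toℕ δ ≡ suc (ol + ol)
    o₁+δ = ℕ.+-cancelˡ-≡ (suc (2 * toℕ l)) _ _ (begin
      suc (2 * toℕ l) + (o₁ + toℕ δ)       ≡⟨ lem₁ (toℕ l) o₁ (toℕ δ) ⟩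
      (2 * toℕ l + toℕ δ) + suc o₁         ≡⟨ cong (_+ suc o₁) (toℕ-combine l δ) ⟨
      toℕ j₁ + suc o₁                       ≡⟨ toℕ-opposite j₁ ⟩
      s * 2                                ≡⟨ cong (_* 2) (toℕ-opposite l) ⟨
      (toℕ l + suc ol) * 2                 ≡⟨ lem₂ (toℕ l) ol ⟩
      suc (2 * toℕ l) + suc (ol + ol)      ∎)
      where
      lem₁ : ∀ l o δ → suc (2 * l) + (o + δ) ≡ (2 * l + δ) + suc o
      lem₁ = solve-∀
      lem₂ : ∀ l o → (l + suc o) * 2 ≡ suc (2 * l) + suc (o + o)
      lem₂ = solve-∀
    o₁+δ+S : o₁ + toℕ δ + S ≡ r * N + s
    o₁+δ+S = begin
      o₁ + toℕ δ + S                  ≡⟨ cong (_+ S) o₁+δ ⟩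
      suc (ol + ol) + S               ≡⟨ lem₁ ol S ⟩
      suc ol + (S + ol)               ≡⟨ cong (suc ol +_) (columnSum l δ) ⟩
      suc ol + (r * N + toℕ l)        ≡⟨ lem₂ ol (r * N) (toℕ l) ⟩
      r * N + (toℕ l + suc ol)        ≡⟨ cong (r * N +_) (toℕ-opposite l) ⟩
      r * N + s                       ∎
      where
      lem₁ : ∀ o S → suc (o + o) + S ≡ suc o + (S + o)
      lem₁ = solve-∀
      lem₂ : ∀ o x l → suc o + (x + l) ≡ x + (l + suc o)
      lem₂ = solve-∀
    rearrange : ∀ S Σx EP Y TT Z o₀ j₀ o₁ j₂ o₂ δ r →
      S + Σx + (((suc (EP + o₀) + suc (Y + j₀)) + (suc (EP + o₁) + suc (Y + j₂))) + (suc (TT + o₂) + suc (Z + 0))) + δ + r ≡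
      (EP + Y + EP + Y + TT + Z + 4) + (j₀ + suc o₀) + (j₂ + suc o₂) + (o₁ + δ + S) + (Σx + r)
    rearrange = solve-∀
    evaluate : ∀ r s →
      let k = s * 2 ; L = r * (2 * s) ; Z = L + L ; EP = Z + 1 ; XO = EP + k + r + r ; XE = XO + r ; Y = XE + r ; TT = Y + k in
      (EP + Y + EP + Y + TT + Z + 4) + k + k + (r * suc (L + L) + s) + (r * suc XE + r * suc XO + r * r) ≡
      (12 * r * r * s + 6 * r * r + 28 * r * s + 16 * r + 13 * s + 9) + r
    evaluate = solve-∀

  -- Every block that meets the hub is summed completely, so only the offsets matter and not the
  -- orders within the blocks.
  f-hub : f hub ≡ hubTotal r s
  f-hub = ℕ.+-cancelʳ-≡ (r + r + s + s) _ _ (begin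
    f hub + (r + r + s + s)
      ≡⟨ cong (_+ (r + r + s + s)) f⁺-hub ⟩
    (sum cycHubLabel + sum (vertexLabel ∘ cyc)) + (sum spokeLabel + sum (vertexLabel ∘ rim)) + (r + r + s + s)
      ≡⟨ rearrange (sum cycHubLabel) (sum (vertexLabel ∘ cyc)) (sum spokeLabel) (sum (vertexLabel ∘ rim)) r s ⟩
    (sum cycHubLabel + r) + (sum (vertexLabel ∘ cyc) + r) + (sum spokeLabel + s) + (sum (vertexLabel ∘ rim) + s)
      ≡⟨ cong₂ _+_ (cong₂ _+_ (cong₂ _+_ cycHubSum cycSum) spokeSum) rimSum ⟩
    (r * suc HE + r * suc HO + r * r) + (r * suc XE + r * suc XO + r * r) + (k * suc TT + 2 * s * s) + (k * suc Y + 2 * s * s)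
      ≡⟨ evaluate r s ⟩
    hubTotal r s + (r + r + s + s) ∎)
    where
    rearrange : ∀ a b c d r s → (a + b) + (c + d) + (r + r + s + s) ≡ (a + r) + (b + r) + (c + s) + (d + s)
    rearrange = solve-∀
    evaluate : ∀ r s →
      let k = s * 2 ; L = r * (2 * s) ; XO = L + L + 1 + k + r + r ; XE = XO + r ; Y = XE + r ; TT = Y + k ; HE = TT + k ; HO = HE + r in
      (r * suc HE + r * suc HO + r * r) + (r * suc XE + r * suc XO + r * r) + (k * suc TT + 2 * s * s) + (k * suc Y + 2 * s * s) ≡
      (16 * r * r * s + 16 * r * r + 16 * r * s * s + 32 * r * s + 6 * r + 16 * s * s + 6 * s) + (r + r + s + s)
    evaluate = solve-∀

-- Comparison of the colours.

private
  +≡⇒≤ : ∀ {a b} p → a + p ≡ b → a ≤ b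
  +≡⇒≤ {a} p eq = ℕ.≤-trans (ℕ.m≤m+n a p) (ℕ.≤-reflexive eq)

-- Each inequality holds because the difference of the two sides has nonnegative coefficients
-- after substituting the lower bounds.

even<odd : ∀ {n s} → 1 ≤ n → 2 ≤ s → let r = suc (n + n) in evenCyc n r s < oddCyc n r s + s * s
even<odd 1≤n 2≤s with (x , refl) ← ℕ.m≤n⇒∃[o]m+o≡n 1≤n | (y , refl) ← ℕ.m≤n⇒∃[o]m+o≡n 2≤s =
  +≡⇒≤ _ (lem x y)
  where
  lem : ∀ x y → let n = suc x ; r = suc (n + n) ; s = 2 + y in
          suc (5 * n + 12 * r * s * s + 32 * r * s + 9 * r + 6 * s * s + 18 * s + 11) + (6 * x + 2 * y * y + 8 * y + 16)
          ≡ (12 * r * s * s + 32 * r * s + 14 * r + 7 * s * s + 18 * s + 9 + n) + s * s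
  lem = solve-∀

odd<hub : ∀ {n s} → 1 ≤ n → 2 ≤ s → let r = suc (n + n) in oddCyc n r s < hubTotal r s
odd<hub 1≤n 2≤s with (x , refl) ← ℕ.m≤n⇒∃[o]m+o≡n 1≤n | (y , refl) ← ℕ.m≤n⇒∃[o]m+o≡n 2≤s =
  +≡⇒≤ _ (lem x y)
  where
  lem : ∀ x y → let n = suc x ; r = suc (n + n) ; s = 2 + y in
          suc (12 * r * s * s + 32 * r * s + 14 * r + 7 * s * s + 18 * s + 9 + n) + (64 * x * x * y + 192 * x * x + 8 * x * y * y + 224 * x * y + 591 * x + 21 * y * y + 216 * y + 457)
          ≡ 16 * r * r * s + 16 * r * r + 16 * r * s * s + 32 * r * s + 6 * r + 16 * s * s + 6 * s
  lem = solve-∀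

rim<hub : ∀ {n s} → 1 ≤ n → 2 ≤ s → let r = suc (n + n) in rimTotal r s < hubTotal r s
rim<hub 1≤n 2≤s with (x , refl) ← ℕ.m≤n⇒∃[o]m+o≡n 1≤n | (y , refl) ← ℕ.m≤n⇒∃[o]m+o≡n 2≤s =
  +≡⇒≤ _ (lem x y)
  where
  lem : ∀ x y → let n = suc x ; r = suc (n + n) ; s = 2 + y in
          suc (12 * r * r * s + 6 * r * r + 28 * r * s + 16 * r + 13 * s + 9) + (16 * x * x * y + 72 * x * x + 32 * x * y * y + 184 * x * y + 340 * x + 64 * y * y + 297 * y + 388)
          ≡ 16 * r * r * s + 16 * r * r + 16 * r * s * s + 32 * r * s + 6 * r + 16 * s * s + 6 * s
  lem = solve-∀

rim<even : ∀ {n s} → 1 ≤ n → let r = suc (n + n) in r ≤ s → rimTotal r s + s * s < evenCyc n r s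
rim<even 1≤n r≤s with (x , refl) ← ℕ.m≤n⇒∃[o]m+o≡n 1≤n with (y , refl) ← ℕ.m≤n⇒∃[o]m+o≡n r≤s =
  +≡⇒≤ _ (lem x y)
  where
  lem : ∀ x y → let n = suc x ; r = suc (n + n) ; s = r + y in
          suc ((12 * r * r * s + 6 * r * r + 28 * r * s + 16 * r + 13 * s + 9) + s * s) + (48 * x * x * y + 12 * x * x + 24 * x * y * y + 172 * x * y + 37 * x + 41 * y * y + 155 * y + 27)
          ≡ 5 * n + 12 * r * s * s + 32 * r * s + 9 * r + 6 * s * s + 18 * s + 11
  lem = solve-∀

-- The leading terms are 12rs² and 12r²s. The extra `suc` is there because the smaller rim colour is
-- `rimTotal` - 1.
odd<rim : ∀ {n r s} → n ≤ r → 2 ≤ s → s < r → suc (oddCyc n r s) < rimTotal r s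
odd<rim {n} {r} n≤r 2≤s s<r with (x , refl) ← ℕ.m≤n⇒∃[o]m+o≡n 2≤s with (y , refl) ← ℕ.m≤n⇒∃[o]m+o≡n s<r =
  -- The summand `n` of `oddCyc` is raised to `r`, so that s = 2 + x and r = s + 1 + y parametrise
  -- the rest without halving `r`.
  ℕ.≤-trans (s≤s (s≤s (ℕ.+-monoʳ-≤ _ n≤r))) (+≡⇒≤ _ (lem x y))
  where
  lem : ∀ x y → let s = 2 + x ; r = suc s + y ; n = r in
          suc (suc (12 * r * s * s + 32 * r * s + 14 * r + 7 * s * s + 18 * s + 9 + n)) + (12 * x * x * y + 7 * x * x + 12 * x * y * y + 80 * x * y + 44 * x + 30 * y * y + 125 * y + 65)
          ≡ 12 * r * r * s + 6 * r * r + 28 * r * s + 16 * r + 13 * s + 9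
  lem = solve-∀

-- The five colours and the theorem.

combine-elim : ∀ {l} (Q : Fin (l * 2) → Set) → (∀ (a : Fin l) ε → Q (combine a ε)) → ∀ i → Q i
combine-elim {l} Q q i with (a , ε , eq) ← combine-surjective {l} {2} i = subst Q eq (q a ε)

module Colours (n s : ℕ) (1≤n : 1 ≤ n) (2≤s : 2 ≤ s) where

  open Totals n s 1≤n 2≤s
  open CycleWheel 3≤m 3≤k using (vertex-elim; proper; χltna≡5)

  l₀ : Fin s
  l₀ = fromℕ< (ℕ.≤-trans (s≤s z≤n) 2≤s)

  cycColour rimColour : Fin 2 → ℕ
  cycColour ε = f (cyc (combine {r} 0F ε))
  rimColour δ = f (rim (combine l₀ δ))

  f-cyc : ∀ (a : Fin r) ε → f (cyc (combine a ε)) ≡ cycColour ε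
  f-cyc a 0F = ℕ.+-cancelʳ-≡ (s * s) _ _ (trans (f-even a) (≡-sym (f-even 0F)))
  f-cyc a 1F = trans (f-odd a) (≡-sym (f-odd 0F))

  f-rim-colour : ∀ (l : Fin s) δ → f (rim (combine l δ)) ≡ rimColour δ
  f-rim-colour l δ = ℕ.+-cancelʳ-≡ (toℕ δ) _ _ (trans (f-rim l δ) (≡-sym (f-rim l₀ δ)))

  rimColour₀ : rimColour 0F ≡ rimTotal r s
  rimColour₀ = trans (≡-sym (ℕ.+-identityʳ (rimColour 0F))) (f-rim l₀ 0F)

  suc-rimColour₁ : suc (rimColour 1F) ≡ rimTotal r s
  suc-rimColour₁ = trans (ℕ.+-comm 1 (rimColour 1F)) (f-rim l₀ 1F)

  cyc₀<cyc₁ : cycColour 0F < cycColour 1F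
  cyc₀<cyc₁ = ℕ.+-cancelʳ-< (s * s) _ _ (subst₂ _<_ (≡-sym (f-even 0F)) (cong (_+ s * s) (≡-sym (f-odd 0F))) (even<odd 1≤n 2≤s))

  rim₁<rim₀ : rimColour 1F < rimColour 0F
  rim₁<rim₀ = ℕ.≤-reflexive (trans suc-rimColour₁ (≡-sym rimColour₀))

  cyc≤cyc₁ : ∀ ε → cycColour ε ≤ cycColour 1F
  cyc≤cyc₁ 0F = ℕ.<⇒≤ cyc₀<cyc₁
  cyc≤cyc₁ 1F = ℕ.≤-refl

  cyc₀≤cyc : ∀ ε → cycColour 0F ≤ cycColour ε
  cyc₀≤cyc 0F = ℕ.≤-refl
  cyc₀≤cyc 1F = ℕ.<⇒≤ cyc₀<cyc₁

  rim≤rim₀ : ∀ δ → rimColour δ ≤ rimColour 0F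
  rim≤rim₀ 0F = ℕ.≤-refl
  rim≤rim₀ 1F = ℕ.<⇒≤ rim₁<rim₀

  rim₁≤rim : ∀ δ → rimColour 1F ≤ rimColour δ
  rim₁≤rim 0F = ℕ.<⇒≤ rim₁<rim₀
  rim₁≤rim 1F = ℕ.≤-refl

  cyc-below-hub : ∀ ε → cycColour ε < f hub
  cyc-below-hub ε = ℕ.≤-<-trans (cyc≤cyc₁ ε) (subst₂ _<_ (≡-sym (f-odd 0F)) (≡-sym f-hub) (odd<hub 1≤n 2≤s))

  rim-below-hub : ∀ δ → rimColour δ < f hub
  rim-below-hub δ = ℕ.≤-<-trans (rim≤rim₀ δ) (subst₂ _<_ (≡-sym rimColour₀) (≡-sym f-hub) (rim<hub 1≤n 2≤s))

  cycColour≢rimColour : ∀ ε δ → cycColour ε ≢ rimColour δ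
  -- The tie r = s falls to the cycle: the cubic terms agree, and the quadratic ones of the smaller
  -- cycle colour win with 37r² against 34r².
  cycColour≢rimColour ε δ = Sum.[ below , above ]′ (ℕ.<-≤-connex s r)
    where
    below : s < r → cycColour ε ≢ rimColour δ
    below s<r = ℕ.<⇒≢ (ℕ.≤-<-trans (cyc≤cyc₁ ε) (ℕ.<-≤-trans cyc₁<rim₁ (rim₁≤rim δ)))
      where
      cyc₁<rim₁ : cycColour 1F < rimColour 1F
      cyc₁<rim₁ = ℕ.s<s⁻¹ (subst₂ _<_ (cong suc (≡-sym (f-odd 0F))) (≡-sym suc-rimColour₁) (odd<rim (ℕ.≤-trans (ℕ.m≤m+n n n) (ℕ.n≤1+n _)) 2≤s s<r))
    above : r ≤ s → cycColour ε ≢ rimColour δ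
    above r≤s = ≢-sym (ℕ.<⇒≢ (ℕ.≤-<-trans (rim≤rim₀ δ) (ℕ.<-≤-trans rim₀<cyc₀ (cyc₀≤cyc ε))))
      where
      rim₀<cyc₀ : rimColour 0F < cycColour 0F
      rim₀<cyc₀ = ℕ.+-cancelʳ-< (s * s) _ _ (subst₂ _<_ (cong (_+ s * s) (≡-sym rimColour₀)) (≡-sym (f-even 0F)) (rim<even 1≤n r≤s))

  cyc≢cyc : ∀ (i : Fin m) → f (cyc i) ≢ f (cyc (next i))
  cyc≢cyc = combine-elim (λ i → f (cyc i) ≢ f (cyc (next i))) λ
    { a 0F eq → ℕ.<⇒≢ cyc₀<cyc₁ (trans (≡-sym (f-cyc a 0F)) (trans eq (trans (cong (f ∘ cyc) (next-combine₀ a)) (f-cyc a 1F))))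
    ; a 1F eq → ℕ.<⇒≢ cyc₀<cyc₁ (trans (≡-sym (f-cyc (next a) 0F)) (trans (cong (f ∘ cyc) (≡-sym (next-combine₁ a))) (trans (≡-sym eq) (f-cyc a 1F))))
    }

  rim≢rim : ∀ (j : Fin k) → f (rim j) ≢ f (rim (next j))
  rim≢rim = combine-elim (λ j → f (rim j) ≢ f (rim (next j))) λ
    { l 0F eq → ℕ.<⇒≢ rim₁<rim₀ (trans (≡-sym (f-rim-colour l 1F)) (trans (cong (f ∘ rim) (≡-sym (next-combine₀ l))) (trans (≡-sym eq) (f-rim-colour l 0F))))
    ; l 1F eq → ℕ.<⇒≢ rim₁<rim₀ (trans (≡-sym (f-rim-colour l 1F)) (trans eq (trans (cong (f ∘ rim) (next-combine₁ l)) (f-rim-colour (next l) 0F))))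
    }

  rim≢hub : ∀ (j : Fin k) → f (rim j) ≢ f hub
  rim≢hub = combine-elim (λ j → f (rim j) ≢ f hub) λ l δ eq → ℕ.<⇒≢ (rim-below-hub δ) (trans (≡-sym (f-rim-colour l δ)) eq)

  cyc≢hub : ∀ (i : Fin m) → f (cyc i) ≢ f hub
  cyc≢hub = combine-elim (λ i → f (cyc i) ≢ f hub) λ a ε eq → ℕ.<⇒≢ (cyc-below-hub ε) (trans (≡-sym (f-cyc a ε)) eq)

  cyc≢rim : ∀ (i : Fin m) (j : Fin k) → f (cyc i) ≢ f (rim j)
  cyc≢rim = combine-elim (λ i → ∀ j → f (cyc i) ≢ f (rim j)) λ a ε →
    combine-elim (λ j → f (cyc (combine a ε)) ≢ f (rim j)) λ l δ eq →
      cycColour≢rimColour ε δ (trans (≡-sym (f-cyc a ε)) (trans eq (f-rim-colour l δ)))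

  colour : Fin 5 → ℕ
  colour 0F = cycColour 0F
  colour 1F = cycColour 1F
  colour 2F = rimColour 0F
  colour 3F = rimColour 1F
  colour 4F = f hub

  f-colour : ∀ v → ∃[ i ] f v ≡ colour i
  f-colour = vertex-elim (λ v → ∃[ i ] f v ≡ colour i)
    (combine-elim (λ i → ∃[ c ] f (cyc i) ≡ colour c) λ { a 0F → 0F , f-cyc a 0F ; a 1F → 1F , f-cyc a 1F })
    (combine-elim (λ j → ∃[ c ] f (rim j) ≡ colour c) λ { l 0F → 2F , f-rim-colour l 0F ; l 1F → 3F , f-rim-colour l 1F })
    (4F , refl)

  result : χltna G ≡ 5
  result = χltna≡5 labeling (λ {u} {v} → proper f cyc≢cyc rim≢rim rim≢hub cyc≢rim cyc≢hub {u} {v}) colour f-colour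

theorem2p8 : ∀ (n s : ℕ) → n ≥ 1 → s ≥ 2 → χltna (C (4 * n + 2) ∨ W (2 * s)) ≡ 5
theorem2p8 n s n≥1 s≥2 = subst₂ (λ m k → χltna (C m ∨ W k) ≡ 5) (order n) (ℕ.*-comm s 2) (Colours.result n s n≥1 s≥2)
  where
  order : ∀ n → suc (n + n) * 2 ≡ 4 * n + 2
  order = solve-∀
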